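{- Let $\varepsilon\in(0,1/4)$ and $b=9$. Let $G=(V,E)$ be a graph and run the following procedure. Let $M_1$ be an $(\varepsilon/4)$-approximately maximal matching in $G$. For each edge of $M_1$ put one endpoint in $L$ and the other in $R$; put each vertex of $V\setminus V(M_1)$ independently and uniformly at random into $L$ or $R$. Let $E_2$ be the set of edges $(u,v)\in E$ with $u\in V(M_1)$, $v\notin V(M_1)$, and $u,v$ on different sides of $(L,R)$. Assign capacity $1$ to vertices of $V(M_1)$ and capacity $b$ to the other vertices, and let $M_2$ be any maximal $b$-matching in $(V,E_2)$ with these capacities. Then $$\mu(G)\ge\mathbb E[\mu(G[M_1\cup M_2])]\ge\left(\frac12+\frac1{144}-\varepsilon\right)\mu(G),$$ so that outputting a maximum matching of $G[M_1\cup M_2]$ gives a $\left(\frac12+\frac1{144}-\varepsilon\right)^{ -1}<1.973(1+2\varepsilon)$ approximation in expectation.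
   Context: $\mu(H)$ is the maximum matching size of a graph $H$; $V(M)$ is the set of endpoints of a matching $M$; $G[F]$ is the subgraph formed by edge set $F$. A matching $M$ is an $\varepsilon'$-approximately maximal matching in $G$ if it is inclusion-wise maximal in some subgraph of $G$ obtained by deleting at most $\varepsilon'\mu(G)$ vertices. A $b$-matching with capacities $\{b_v\}$ is a multiset of edges in which each vertex $v$ lies in at most $b_v$ elements; maximal means no edge copy can be added while respecting capacities. Expectation is over the random bipartition.
   Formalization: The closing comparison of (1/2+1/144-ε)^{ -1} with 1.973(1+2ε) is omitted: it fails for larger ε in (0,1/4), e.g. ε=0.05 gives about 2.188 > 2.1703. Only the displayed chain of inequalities is stated, with rational ε, which loses nothing. -}

module Defs where

open import Data.Nat as ℕ using (ℕ; zero; suc; _^_; _<_)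
open import Data.Nat.Properties using (m^n≢0)
open import Data.Bool using (Bool; true; false; if_then_else_; _∨_)
open import Data.Fin using (Fin; _≟_)
import Data.Fin as F
open import Data.List using (List; []; _∷_; _++_; length; map; concatMap)
open import Data.Nat.ListAction using (sum)
open import Data.List.Membership.Propositional using (_∈_; _∉_)
open import Data.List.Relation.Unary.All using (All)
open import Data.List.Relation.Unary.Unique.Propositional using (Unique)
open import Data.Product using (_×_; _,_; proj₁; proj₂; ∃)
open import Data.Sum using (_⊎_)
open import Data.Empty using (⊥)
open import Relation.Nullary using (¬_; Dec; yes; no)
open import Relation.Nullary.Decidable using (⌊_⌋)
open import Relation.Binary.PropositionalEquality using (_≡_; _≢_)
open import Data.Integer using (+_)
open import Data.Rational using (ℚ; _/_)

record Graph (n : ℕ) : Set₁ where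
  field
    Adj     : Fin n → Fin n → Set
    symm    : ∀ {u v} → Adj u v → Adj v u
    irrefl  : ∀ {u} → ¬ Adj u u
open Graph public

Rel : ℕ → Set₁
Rel n = Fin n → Fin n → Set

-- an edge list (ordered pairs, each pair stands for the edge {u,v})
Edges : ℕ → Set
Edges n = List (Fin n × Fin n)

endpoints : ∀ {n} → Edges n → List (Fin n)
endpoints = concatMap (λ e → proj₁ e ∷ proj₂ e ∷ [])

IsMatching : ∀ {n} → Rel n → Edges n → Set
IsMatching H M = All (λ e → H (proj₁ e) (proj₂ e)) M × Unique (endpoints M)

IsMaximalMatching : ∀ {n} → Rel n → Edges n → Set
IsMaximalMatching H M =
  IsMatching H M × (∀ u v → H u v → (u ∈ endpoints M) ⊎ (v ∈ endpoints M))

IsMu : ∀ {n} → Rel n → ℕ → Set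
IsMu H m = (∃ λ M → IsMatching H M × length M ≡ m)
         × (∀ M → IsMatching H M → length M ℕ.≤ m)

deleteVertices : ∀ {n} → Rel n → List (Fin n) → Rel n
deleteVertices H S u v = H u v × u ∉ S × v ∉ S

toℚ : ℕ → ℚ
toℚ k = + k / 1

-- M is an ε'-approximately maximal matching in G (with μ(G) = mG):
-- maximal in G − S for some S with |S| ≤ ε' μ(G)
IsApproxMaximal : ∀ {n} → Rel n → ℕ → ℚ → Edges n → Set
IsApproxMaximal {n} H mG ε' M =
  ∃ λ (S : List (Fin n)) → Unique S × (toℚ (length S) Data.Rational.≤ ε' Data.Rational.* toℚ mG)
      × IsMaximalMatching (deleteVertices H S) M
  where open import Data.Rational using (_≤_; _*_)

edgeGraph : ∀ {n} → Edges n → Rel n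
edgeGraph F u v = ((u , v) ∈ F) ⊎ ((v , u) ∈ F)

occursFst : ∀ {n} → Edges n → Fin n → Bool
occursFst [] v = false
occursFst ((a , _) ∷ M) v = if ⌊ a ≟ v ⌋ then true else occursFst M v

occursSnd : ∀ {n} → Edges n → Fin n → Bool
occursSnd [] v = false
occursSnd ((_ , b) ∷ M) v = if ⌊ b ≟ v ⌋ then true else occursSnd M v

-- The side of v (true = L, false = R): for each pair (u,v) of M1 the first
-- component goes to L and the second to R; unmatched vertices follow σ.
side : ∀ {n} → Edges n → (Fin n → Bool) → Fin n → Bool
side M1 σ v =
  if occursFst M1 v then true else (if occursSnd M1 v then false else σ v)

E₂dir : ∀ {n} → Graph n → Edges n → (Fin n → Bool) → Rel n
E₂dir G M1 σ u v =
  Adj G u v × u ∈ endpoints M1 × v ∉ endpoints M1 × side M1 σ u ≢ side M1 σ v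

E₂ : ∀ {n} → Graph n → Edges n → (Fin n → Bool) → Rel n
E₂ G M1 σ u v = E₂dir G M1 σ u v ⊎ E₂dir G M1 σ v u

deg : ∀ {n} → Edges n → Fin n → ℕ
deg [] v = 0
deg ((a , b) ∷ M) v =
  (if ⌊ a ≟ v ⌋ then 1 else 0) ℕ.+ (if ⌊ b ≟ v ⌋ then 1 else 0) ℕ.+ deg M v

capacity : ∀ {n} → ℕ → Edges n → Fin n → ℕ
capacity b M1 v = if occursFst M1 v ∨ occursSnd M1 v then 1 else b

-- b-matching (multiset = list with repetitions) in H with capacities cap
IsBMatching : ∀ {n} → Rel n → (Fin n → ℕ) → Edges n → Set
IsBMatching H cap M = All (λ e → H (proj₁ e) (proj₂ e)) M × (∀ v → deg M v ℕ.≤ cap v)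

IsMaximalBMatching : ∀ {n} → Rel n → (Fin n → ℕ) → Edges n → Set
IsMaximalBMatching H cap M =
  IsBMatching H cap M × (∀ u v → H u v → ¬ (deg M u < cap u × deg M v < cap v))

extend : ∀ {n} → Bool → (Fin n → Bool) → Fin (suc n) → Bool
extend b f F.zero = b
extend b f (F.suc i) = f i

allAssign : (n : ℕ) → List (Fin n → Bool)
allAssign zero = (λ ()) ∷ []
allAssign (suc n) = concatMap (λ f → extend false f ∷ extend true f ∷ []) (allAssign n)

expect : (n : ℕ) → ((Fin n → Bool) → ℕ) → ℚ
expect n X = _/_ (+ sum (map X (allAssign n))) (2 ^ n) {{m^n≢0 2 n}}

{-# OPTIONS --safe #-}
module Submission where

-- Let k = |M₁|, μ = μ(G), and let S be the set of deleted vertices.  Fix an assignment σ, let q be the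
-- number of length-3 augmenting paths a–u–v–c for M₁ inside the optimal matching M⋆ both of whose wings
-- ua and vc cross the bipartition, and let t be the number of edges of M₁ with both ends met by M₂.
-- Then |M₂| ≤ k + t and, as a missed wing saturates its outer vertex with 9 edges of M₂,
-- 9q ≤ 9t + |M₂|; so 10t ≥ 9q − k.  Every edge of M₁ ∪ M₂ crosses the bipartition, and M₁ ∪ M₂ carries a
-- fractional matching of weight k + t/9, so by Kőnig's theorem 90 μ(M₁ ∪ M₂) ≥ 89k + 9q.
-- Both wings of a path cross with probability 1/4, there are at least 2μ − 2|S| − 3k paths, and
-- 2k ≥ μ − |S|; hence E[μ(M₁ ∪ M₂)] ≥ (73/144)(μ − |S|).

open import Defs

-- The constant 1/144 and the capacity 9 come from one calculation. With capacity b the three bounds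
-- read |M₂| ≤ k + t, bq ≤ bt + |M₂| and weight k + t/b, so μ(M₁ ∪ M₂) ≥ k + (bq - k)/(b(b + 1)). In
-- the extremal case S = ∅, k = μ/2, the guaranteed expectation of q is k/4 and the gain is k(b -
-- 4)/(4b(b + 1)). Over all b this is largest at b = 8 and b = 9, where it equals k/72 = μ/144. A
-- larger k only raises the bound. The fractional matching puts 1/9 on the two M₂-edges at an
-- M₁-edge with both ends met, 8/9 on that M₁-edge, and 1 on every other M₁-edge. It is never
-- written down: by duality it suffices that every integral vertex cover has size at least k + t/9,
-- and Kőnig's theorem supplies a cover no larger than a maximum matching. This is why the
-- bipartition must separate the ends of the M₁-edges as well. Indicators are the numbers 0 and 1,
-- so each charging argument becomes a product summed over edges; `handshake` moves it to the
-- vertices and from there to another edge list. Subtractions are avoided by adding the same terms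
-- to both sides.

module Combinatorics where

  open import Data.Bool using (Bool; true; false; if_then_else_; _∨_; not; _xor_)
  import Data.Bool as Bool
  open import Data.Bool.Properties using (¬-not; ∨-zeroʳ)
  open import Data.Fin using (Fin; _≟_)
  import Data.Fin as F
  open import Data.List using (List; []; _∷_; _++_; length; map; concatMap; allFin)
  open import Data.List.Membership.Propositional using (_∈_; _∉_)
  open import Data.List.Membership.Propositional.Properties using (∈-allFin; ∈-++⁺ˡ; ∈-++⁺ʳ; ∈-++⁻; ∈-map⁺; ∈-map⁻)
  open import Data.List.Properties using (length-map)
  open import Data.List.Relation.Unary.All as All using (All; []; _∷_)
  import Data.List.Relation.Unary.All.Properties as All
  open import Data.List.Relation.Unary.AllPairs using ([]; _∷_)
  open import Data.List.Relation.Unary.Any using (here; there; any?)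
  open import Data.List.Relation.Unary.Unique.Propositional using (Unique)
  open import Data.List.Relation.Unary.Unique.Propositional.Properties using (allFin⁺)
  open import Data.Nat using (ℕ; zero; suc; _+_; _*_; _∸_; _^_; _≤_; _<_; z≤n; s≤s)
  open import Data.Nat.Properties hiding (_≟_)
  open import Data.Nat.ListAction using (sum)
  open import Data.Nat.Tactic.RingSolver using (solve-∀)
  open import Data.Product using (_×_; _,_; proj₁; proj₂; ∃)
  open import Data.Sum using (_⊎_; inj₁; inj₂; [_,_]′)
  open import Function using (_∘_; id; case_of_)
  open import Relation.Nullary using (¬_; Dec; yes; no; contradiction)
  open import Relation.Nullary.Decidable using (⌊_⌋; decidable-stable; ¬¬-excluded-middle)
  open import Relation.Binary.PropositionalEquality using (_≡_; _≢_; refl; sym; trans; cong; cong₂; subst; module ≡-Reasoning)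

  private variable
    A B : Set
    n : ℕ

  -- Finite sums and incidence counts

  ∑ : List A → (A → ℕ) → ℕ
  ∑ xs f = sum (map f xs)

  ∑-mono : (xs : List A) {f g : A → ℕ} → (∀ {x} → x ∈ xs → f x ≤ g x) → ∑ xs f ≤ ∑ xs g
  ∑-mono []       f≤g = z≤n
  ∑-mono (x ∷ xs) f≤g = +-mono-≤ (f≤g (here refl)) (∑-mono xs (f≤g ∘ there))

  ∑-cong : (xs : List A) {f g : A → ℕ} → (∀ {x} → x ∈ xs → f x ≡ g x) → ∑ xs f ≡ ∑ xs g
  ∑-cong []       f≡g = refl
  ∑-cong (x ∷ xs) f≡g = cong₂ _+_ (f≡g (here refl)) (∑-cong xs (f≡g ∘ there))

  private
    interchange : ∀ a b c d → (a + b) + (c + d) ≡ (a + c) + (b + d)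
    interchange = solve-∀

  ∑-+ : (xs : List A) (f g : A → ℕ) → ∑ xs (λ x → f x + g x) ≡ ∑ xs f + ∑ xs g
  ∑-+ []       f g = refl
  ∑-+ (x ∷ xs) f g = trans (cong (f x + g x +_) (∑-+ xs f g)) (interchange (f x) (g x) _ _)

  ∑-* : (c : ℕ) (xs : List A) (f : A → ℕ) → ∑ xs (λ x → c * f x) ≡ c * ∑ xs f
  ∑-* c []       f = sym (*-zeroʳ c)
  ∑-* c (x ∷ xs) f = trans (cong (c * f x +_) (∑-* c xs f)) (sym (*-distribˡ-+ c (f x) _))

  ∑-const : (c : ℕ) (xs : List A) → ∑ xs (λ _ → c) ≡ length xs * c
  ∑-const c []       = refl
  ∑-const c (x ∷ xs) = cong (c +_) (∑-const c xs)

  ∑-comm : (xs : List A) (ys : List B) (f : A → B → ℕ) →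
           ∑ xs (λ x → ∑ ys (f x)) ≡ ∑ ys (λ y → ∑ xs (λ x → f x y))
  ∑-comm []       ys f = sym (trans (∑-const 0 ys) (*-zeroʳ (length ys)))
  ∑-comm (x ∷ xs) ys f =
    trans (cong (∑ ys (f x) +_) (∑-comm xs ys f)) (sym (∑-+ ys (f x) _))

  ∑-∈ : (f : A → ℕ) {x : A} {xs : List A} → x ∈ xs → f x ≤ ∑ xs f
  ∑-∈ f (here refl) = m≤m+n _ _
  ∑-∈ f (there x∈)  = m≤n⇒m≤o+n _ (∑-∈ f x∈)

  ∑-positive : (xs : List A) (f : A → ℕ) → 1 ≤ ∑ xs f → ∃ λ x → x ∈ xs × 1 ≤ f x
  ∑-positive (x ∷ xs) f p with f x in eq
  ... | suc _ = x , here refl , subst (1 ≤_) (sym eq) (s≤s z≤n)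
  ... | zero with y , y∈ , q ← ∑-positive xs f p = y , there y∈ , q

  δ : Fin n → Fin n → ℕ
  δ a v = if ⌊ a ≟ v ⌋ then 1 else 0

  δ-refl : (a : Fin n) → δ a a ≡ 1
  δ-refl a with a ≟ a
  ... | yes _  = refl
  ... | no a≢a = contradiction refl a≢a

  δ-≢ : {a v : Fin n} → a ≢ v → δ a v ≡ 0
  δ-≢ {a = a} {v} a≢v with a ≟ v
  ... | yes a≡v = contradiction a≡v a≢v
  ... | no _    = refl

  δ-positive : {a v : Fin n} → 1 ≤ δ a v → a ≡ v
  δ-positive {a = a} {v} p with a ≟ v
  ... | yes a≡v = a≡v

  ∑-δ : (a : Fin n) (f : Fin n → ℕ) → ∑ (allFin n) (λ v → f v * δ a v) ≡ f a
  ∑-δ {n} a f = unique (allFin⁺ n) (∈-allFin a)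
    where
    vanish : ∀ {xs} → All (a ≢_) xs → ∑ xs (λ v → f v * δ a v) ≡ 0
    vanish []         = refl
    vanish (a≢x ∷ ps) rewrite δ-≢ a≢x = cong₂ _+_ (*-zeroʳ (f _)) (vanish ps)
    unique : ∀ {xs} → Unique xs → a ∈ xs → ∑ xs (λ v → f v * δ a v) ≡ f a
    unique (p ∷ ps) (here refl) rewrite δ-refl a =
      trans (cong₂ _+_ (*-identityʳ (f a)) (vanish p)) (+-identityʳ (f a))
    unique (p ∷ ps) (there a∈) rewrite δ-≢ (All.lookup p a∈ ∘ sym) =
      cong₂ _+_ (*-zeroʳ (f _)) (unique ps a∈)

  ∑ₑ : Edges n → (Fin n → Fin n → ℕ) → ℕ
  ∑ₑ M h = ∑ M (λ e → h (proj₁ e) (proj₂ e))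

  -- The weight `g x y` is read outwards from `x`, whichever way the pair is stored. An asymmetric
  -- `g` lets a vertex be weighted by a property of its neighbour.
  incidence : Edges n → (Fin n → Fin n → ℕ) → Fin n → ℕ
  incidence M g v = ∑ₑ M (λ x y → g x y * δ x v + g y x * δ y v)

  -- Double counting of vertex-edge incidences. When `f` contains the degree in one edge list, this
  -- trades a sum over that list for a sum over `M`.
  handshake : (M : Edges n) (f : Fin n → ℕ) (g : Fin n → Fin n → ℕ) →
    ∑ (allFin n) (λ v → f v * incidence M g v) ≡ ∑ₑ M (λ x y → f x * g x y + f y * g y x)
  handshake {n} M f g =
    trans (∑-cong (allFin n) λ {v} _ → sym (∑-* (f v) M _))
   (trans (∑-comm (allFin n) M _) (∑-cong M λ {e} _ → edge (proj₁ e) (proj₂ e)))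
    where
    V = allFin n
    assoc₂ : ∀ a b c d e → a * (b * c + d * e) ≡ a * b * c + a * d * e
    assoc₂ = solve-∀
    edge : ∀ x y → ∑ V (λ v → f v * (g x y * δ x v + g y x * δ y v)) ≡ f x * g x y + f y * g y x
    edge x y =
      trans (∑-cong V λ {v} _ → assoc₂ (f v) (g x y) (δ x v) (g y x) (δ y v))
     (trans (∑-+ V _ _)
            (cong₂ _+_ (∑-δ x (λ v → f v * g x y)) (∑-δ y (λ v → f v * g y x))))

  deg-incidence : (M : Edges n) (v : Fin n) → deg M v ≡ incidence M (λ _ _ → 1) v
  deg-incidence []            v = refl
  deg-incidence ((a , b) ∷ M) v =
    cong₂ _+_ (cong₂ _+_ (sym (+-identityʳ (δ a v))) (sym (+-identityʳ (δ b v)))) (deg-incidence M v)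

  handshake-deg : (M : Edges n) (f : Fin n → ℕ) →
    ∑ (allFin n) (λ v → f v * deg M v) ≡ ∑ₑ M (λ x y → f x + f y)
  handshake-deg {n} M f =
    trans (∑-cong (allFin n) λ {v} _ → cong (f v *_) (deg-incidence M v))
   (trans (handshake M f _)
          (∑-cong M λ {e} _ → cong₂ _+_ (*-identityʳ (f (proj₁ e))) (*-identityʳ (f (proj₂ e)))))

  incidence≤deg : (M : Edges n) {g : Fin n → Fin n → ℕ} → (∀ x y → g x y ≤ 1) →
    ∀ v → incidence M g v ≤ deg M v
  incidence≤deg M g≤1 v rewrite deg-incidence M v =
    ∑-mono M λ {e} _ → +-mono-≤ (*-monoˡ-≤ (δ (proj₁ e) v) (g≤1 (proj₁ e) (proj₂ e))) (*-monoˡ-≤ (δ (proj₂ e) v) (g≤1 (proj₂ e) (proj₁ e)))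

  edgeGraph-sym : (M : Edges n) {u v : Fin n} → edgeGraph M u v → edgeGraph M v u
  edgeGraph-sym M = [ inj₂ , inj₁ ]′

  incidence-∈ : (M : Edges n) (g : Fin n → Fin n → ℕ) {u v : Fin n} →
    edgeGraph M u v → g u v ≤ incidence M g u
  incidence-∈ M g {u} {v} (inj₁ e∈) = ≤-trans
    (≤-reflexive (trans (sym (*-identityʳ _)) (cong (g u v *_) (sym (δ-refl u)))))
    (≤-trans (m≤m+n _ _) (∑-∈ _ e∈))
  incidence-∈ M g {u} {v} (inj₂ e∈) = ≤-trans
    (≤-reflexive (trans (sym (*-identityʳ _)) (cong (g u v *_) (sym (δ-refl u)))))
    (≤-trans (m≤n+m _ _) (∑-∈ _ e∈))

  incidence-positive : (M : Edges n) (g : Fin n → Fin n → ℕ) {u : Fin n} →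
    1 ≤ incidence M g u → ∃ λ v → edgeGraph M u v × 1 ≤ g u v
  incidence-positive M g {u} p with ∑-positive M _ p
  ... | (x , y) , e∈ , q = split (g x y * δ x u) refl q
    where
    factor : ∀ a {x} → 1 ≤ a * δ x u → 1 ≤ a × x ≡ u
    factor a {x} r = factorˡ a (δ x u) r , δ-positive (factorʳ a (δ x u) r)
      where
      factorˡ : ∀ a b → 1 ≤ a * b → 1 ≤ a
      factorˡ (suc a) b r = s≤s z≤n
      factorʳ : ∀ a b → 1 ≤ a * b → 1 ≤ b
      factorʳ a zero    r rewrite *-zeroʳ a = r
      factorʳ a (suc b) r = s≤s z≤n
    split : ∀ k → g x y * δ x u ≡ k → 1 ≤ k + g y x * δ y u → ∃ λ v → edgeGraph M u v × 1 ≤ g u v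
    split (suc k) eq _ with factor (g x y) {x} (subst (1 ≤_) (sym eq) (s≤s z≤n))
    ... | r , refl = y , inj₁ e∈ , r
    split zero eq r with factor (g y x) {y} r
    ... | r′ , refl = x , inj₂ e∈ , r′

  -- Matchings

  edgeGraph-∷ : {M : Edges n} {p q u a : Fin n} → edgeGraph ((p , q) ∷ M) u a →
    (u ≡ p × a ≡ q) ⊎ (u ≡ q × a ≡ p) ⊎ edgeGraph M u a
  edgeGraph-∷ (inj₁ (here refl)) = inj₁ (refl , refl)
  edgeGraph-∷ (inj₁ (there e∈))  = inj₂ (inj₂ (inj₁ e∈))
  edgeGraph-∷ (inj₂ (here refl)) = inj₂ (inj₁ (refl , refl))
  edgeGraph-∷ (inj₂ (there e∈))  = inj₂ (inj₂ (inj₂ e∈))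

  ∈-endpoints⁺ : {M : Edges n} {u v : Fin n} → edgeGraph M u v → u ∈ endpoints M
  ∈-endpoints⁺ (inj₁ (here refl)) = here refl
  ∈-endpoints⁺ (inj₁ (there e∈))  = there (there (∈-endpoints⁺ (inj₁ e∈)))
  ∈-endpoints⁺ (inj₂ (here refl)) = there (here refl)
  ∈-endpoints⁺ (inj₂ (there e∈))  = there (there (∈-endpoints⁺ (inj₂ e∈)))

  ∈-endpoints⁻ : (M : Edges n) {u : Fin n} → u ∈ endpoints M → ∃ (edgeGraph M u)
  ∈-endpoints⁻ (e ∷ M) (here refl)         = _ , inj₁ (here refl)
  ∈-endpoints⁻ (e ∷ M) (there (here refl)) = _ , inj₂ (here refl)
  ∈-endpoints⁻ (e ∷ M) (there (there u∈)) with ∈-endpoints⁻ M u∈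
  ... | v , inj₁ e∈ = v , inj₁ (there e∈)
  ... | v , inj₂ e∈ = v , inj₂ (there e∈)

  ∈⇒1≤deg : (M : Edges n) {u : Fin n} → u ∈ endpoints M → 1 ≤ deg M u
  ∈⇒1≤deg M {u} u∈ rewrite deg-incidence M u = incidence-∈ M (λ _ _ → 1) (proj₂ (∈-endpoints⁻ M u∈))

  1≤deg⇒∈ : (M : Edges n) {u : Fin n} → 1 ≤ deg M u → u ∈ endpoints M
  1≤deg⇒∈ M {u} p rewrite deg-incidence M u with incidence-positive M (λ _ _ → 1) p
  ... | _ , e , _ = ∈-endpoints⁺ e

  ∉⇒deg≡0 : (M : Edges n) {u : Fin n} → u ∉ endpoints M → deg M u ≡ 0
  ∉⇒deg≡0 M {u} u∉ with deg M u in eq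
  ... | zero  = refl
  ... | suc _ = contradiction (1≤deg⇒∈ M (subst (1 ≤_) (sym eq) (s≤s z≤n))) u∉

  unique⇒deg≤1 : (M : Edges n) → Unique (endpoints M) → ∀ v → deg M v ≤ 1
  unique⇒deg≤1 []            _ v = z≤n
  unique⇒deg≤1 ((p , q) ∷ M) ((p≢q ∷ p∉) ∷ q∉ ∷ uniq) v with p ≟ v | q ≟ v
  ... | yes refl | yes refl = contradiction refl p≢q
  ... | yes refl | no _     = s≤s (≤-reflexive (∉⇒deg≡0 M (All.All¬⇒¬Any p∉)))
  ... | no _     | yes refl = s≤s (≤-reflexive (∉⇒deg≡0 M (All.All¬⇒¬Any q∉)))
  ... | no _     | no _     = unique⇒deg≤1 M uniq v

  ∈⇒deg≡1 : (M : Edges n) → Unique (endpoints M) → {v : Fin n} → v ∈ endpoints M → deg M v ≡ 1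
  ∈⇒deg≡1 M uniq v∈ = ≤-antisym (unique⇒deg≤1 M uniq _) (∈⇒1≤deg M v∈)

  mate-unique : (M : Edges n) → Unique (endpoints M) → {u a b : Fin n} →
    edgeGraph M u a → edgeGraph M u b → a ≡ b
  mate-unique [] _ (inj₁ ())
  mate-unique [] _ (inj₂ ())
  mate-unique ((p , q) ∷ M) ((p≢q ∷ p∉) ∷ q∉ ∷ uniq) e f with edgeGraph-∷ e | edgeGraph-∷ f
  ... | inj₁ (refl , refl)        | inj₁ (_ , refl)           = refl
  ... | inj₁ (refl , refl)        | inj₂ (inj₁ (refl , refl)) = refl
  ... | inj₁ (refl , _)           | inj₂ (inj₂ f′)            = contradiction (∈-endpoints⁺ f′) (All.All¬⇒¬Any p∉)
  ... | inj₂ (inj₁ (refl , refl)) | inj₁ (refl , refl)        = refl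
  ... | inj₂ (inj₁ (refl , refl)) | inj₂ (inj₁ (_ , refl))    = refl
  ... | inj₂ (inj₁ (refl , _))    | inj₂ (inj₂ f′)            = contradiction (∈-endpoints⁺ f′) (All.All¬⇒¬Any q∉)
  ... | inj₂ (inj₂ e′)            | inj₁ (refl , _)           = contradiction (∈-endpoints⁺ e′) (All.All¬⇒¬Any p∉)
  ... | inj₂ (inj₂ e′)            | inj₂ (inj₁ (refl , _))    = contradiction (∈-endpoints⁺ e′) (All.All¬⇒¬Any q∉)
  ... | inj₂ (inj₂ e′)            | inj₂ (inj₂ f′)            = mate-unique M uniq e′ f′

  -- Injectivity is asked only on members of the list, because renaming `l` to `z` identifies these
  -- two vertices and is injective only where `z` is absent.
  unique-map : {f : A → B} {xs : List A} → (∀ {x y} → x ∈ xs → y ∈ xs → f x ≡ f y → x ≡ y) →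
    Unique xs → Unique (map f xs)
  unique-map inj []       = []
  unique-map inj (p ∷ ps) =
    All.map⁺ (All.tabulate λ y∈ eq → All.lookup p y∈ (inj (here refl) (there y∈) eq))
    ∷ unique-map (λ x∈ y∈ → inj (there x∈) (there y∈)) ps

  -- Double-negation shift, valid because `Fin n` is finite. It allows a predicate to be assumed
  -- decidable at all vertices simultaneously when the goal is a negation.
  ¬¬-∀Fin : (P : Fin n → Set) → (∀ i → ¬ ¬ P i) → ¬ ¬ (∀ i → P i)
  ¬¬-∀Fin {zero}  P ¬¬P ¬∀P = ¬∀P λ ()
  ¬¬-∀Fin {suc n} P ¬¬P ¬∀P = ¬¬P F.zero λ p₀ → ¬¬-∀Fin (P ∘ F.suc) (¬¬P ∘ F.suc) λ p →
    ¬∀P λ { F.zero → p₀ ; (F.suc i) → p i }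

  -- Kőnig's theorem

  rename : Fin n → Fin n → Fin n → Fin n
  rename l z v = if ⌊ l ≟ v ⌋ then z else v

  rename-≢ : {l z v : Fin n} → l ≢ v → rename l z v ≡ v
  rename-≢ {l = l} {v = v} l≢v with l ≟ v
  ... | yes l≡v = contradiction l≡v l≢v
  ... | no _    = refl

  renameEdges : Fin n → Fin n → Edges n → Edges n
  renameEdges l z = map (λ e → rename l z (proj₁ e) , rename l z (proj₂ e))

  endpoints-rename : (l z : Fin n) (M : Edges n) →
    endpoints (renameEdges l z M) ≡ map (rename l z) (endpoints M)
  endpoints-rename l z []      = refl
  endpoints-rename l z (e ∷ M) = cong (λ xs → _ ∷ _ ∷ xs) (endpoints-rename l z M)

  edgeGraph-⊆ : {H : Rel n} → (∀ {u v} → H u v → H v u) → {M : Edges n} →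
    All (λ e → H (proj₁ e) (proj₂ e)) M → ∀ {u v} → edgeGraph M u v → H u v
  edgeGraph-⊆ H-sym hs (inj₁ e∈) = All.lookup hs e∈
  edgeGraph-⊆ H-sym hs (inj₂ e∈) = H-sym (All.lookup hs e∈)

  module Kőnig {n : ℕ} (H : Rel n) (H-sym : ∀ {u v} → H u v → H v u)
    (colour : Fin n → Bool) (bipartite : ∀ {u v} → H u v → colour u ≢ colour v) where

    same-colour : ∀ {x b l} → H x b → H b l → colour x ≡ colour l
    same-colour xb bl = trans (¬-not (bipartite xb)) (sym (¬-not (bipartite bl ∘ sym)))

    -- `k` only bounds the number of steps and vertices may repeat, so a path can be cut short
    -- without bookkeeping. `k` is also the measure on which the augmentation recurses.
    data Alternating (M : Edges n) : ℕ → Fin n → Fin n → Set where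
      stop : ∀ {k x} → Alternating M k x x
      step : ∀ {k x b l z} → H x b → edgeGraph M b l → Alternating M k l z → Alternating M (suc k) x z

    extend-alternating : ∀ {M k x y b l} → Alternating M k x y → H y b → edgeGraph M b l →
      Alternating M (suc k) x l
    extend-alternating stop          yb bl = step yb bl stop
    extend-alternating (step xb e p) yb bl = step xb e (extend-alternating p yb bl)

    weaken : ∀ {M k x z} → Alternating M k x z → Alternating M (suc k) x z
    weaken stop         = stop
    weaken (step h e p) = step h e (weaken p)

    -- Flipping the first two edges z₀ – b – l of an alternating path replaces the matching edge bl by
    -- bz₀, which is the effect of renaming l to z₀.
    module Flip (M : Edges n) (matching : IsMatching H M) {z₀ b l : Fin n}
      (z₀∉ : z₀ ∉ endpoints M) (z₀b : H z₀ b) (bl : edgeGraph M b l) where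

      M′ : Edges n
      M′ = renameEdges l z₀ M

      private
        ⊆H : ∀ {u v} → edgeGraph M u v → H u v
        ⊆H = edgeGraph-⊆ H-sym (proj₁ matching)

        l≢z₀ : l ≢ z₀
        l≢z₀ refl = z₀∉ (∈-endpoints⁺ (edgeGraph-sym M bl))

        inj : ∀ {x y} → x ∈ endpoints M → y ∈ endpoints M → rename l z₀ x ≡ rename l z₀ y → x ≡ y
        inj {x} {y} x∈ y∈ eq with l ≟ x | l ≟ y
        ... | yes refl | yes refl = refl
        ... | yes refl | no _     = contradiction (subst (_∈ endpoints M) (sym eq) y∈) z₀∉
        ... | no _     | yes refl = contradiction (subst (_∈ endpoints M) eq x∈) z₀∉
        ... | no _     | no _     = eq

        mate-l : ∀ {x} → edgeGraph M l x → b ≡ x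
        mate-l = mate-unique M (proj₂ matching) (edgeGraph-sym M bl)

        b≢l : b ≢ l
        b≢l refl = bipartite (⊆H bl) refl

        edge : ∀ {x y} → edgeGraph M x y → H (rename l z₀ x) (rename l z₀ y)
        edge {x} {y} e with l ≟ x | l ≟ y
        ... | yes refl | yes refl = contradiction (mate-l e) b≢l
        ... | yes refl | no _     = subst (H z₀) (mate-l e) z₀b
        ... | no _     | yes refl = H-sym (subst (H z₀) (mate-l (edgeGraph-sym M e)) z₀b)
        ... | no _     | no _     = ⊆H e

      isMatching : IsMatching H M′
      isMatching = All.map⁺ (All.tabulate λ e∈ → edge (inj₁ e∈))
                 , subst Unique (sym (endpoints-rename l z₀ M)) (unique-map inj (proj₂ matching))

      length-M′ : length M′ ≡ length M
      length-M′ = length-map _ M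

      endpoints-M′ : ∀ {v} → v ∈ endpoints M′ → v ≡ z₀ ⊎ (v ∈ endpoints M × v ≢ l)
      endpoints-M′ v∈ with ∈-map⁻ (rename l z₀) (subst (_ ∈_) (endpoints-rename l z₀ M) v∈)
      ... | w , w∈ , eq with l ≟ w
      ... | yes refl = inj₁ eq
      ... | no l≢w   = inj₂ (subst (_∈ endpoints M) (sym eq) w∈ , λ v≡l → l≢w (trans (sym v≡l) eq))

      l∉M′ : l ∉ endpoints M′
      l∉M′ l∈ with endpoints-M′ l∈
      ... | inj₁ l≡z₀      = l≢z₀ l≡z₀
      ... | inj₂ (_ , l≢l) = l≢l refl

      edge-M′ : ∀ {x y} → l ≢ x → l ≢ y → edgeGraph M x y → edgeGraph M′ x y
      edge-M′ {x} {y} l≢x l≢y e with e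
      ... | inj₁ e∈ = inj₁ (subst (_∈ M′) (cong₂ _,_ (rename-≢ l≢x) (rename-≢ l≢y)) (∈-map⁺ _ e∈))
      ... | inj₂ e∈ = inj₂ (subst (_∈ M′) (cong₂ _,_ (rename-≢ l≢y) (rename-≢ l≢x)) (∈-map⁺ _ e∈))

      -- A path through l is cut short there, so that it never uses the flipped edge.
      transfer : ∀ {k x z} → colour x ≡ colour l → Alternating M k x z →
        Alternating M′ k x z ⊎ Alternating M′ k l z
      transfer x∼l stop = inj₁ stop
      transfer x∼l (step {x = x} {b = c} {l = y} xc cy p) with l ≟ y
      ... | yes refl = inj₂ (weaken ([ id , id ]′ (transfer refl p)))
      ... | no l≢y with transfer (trans (sym (same-colour xc (⊆H cy))) x∼l) p
      ...   | inj₁ p′ = inj₁ (step xc (edge-M′ (λ l≡c → bipartite xc (trans x∼l (cong colour l≡c))) l≢y cy) p′)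
      ...   | inj₂ p′ = inj₂ (weaken p′)

    module _ {m : ℕ} (maximum : ∀ M → IsMatching H M → length M ≤ m) where

      -- Instead of flipping a whole path at once, one flip frees `l` in place of `x`, keeps the
      -- size of the matching and leaves a shorter path from `l`. Once the path is empty, the last
      -- edge joins two free vertices and would enlarge a maximum matching. The matching changes
      -- along the way, hence the recursion over all matchings of size `m`.
      no-augmenting-path : ∀ k {M x z b} → IsMatching H M → length M ≡ m → x ∉ endpoints M →
        Alternating M k x z → H z b → b ∈ endpoints M
      no-augmenting-path k {M} {x} {z} {b} matching refl x∉ path zb =
        decidable-stable (any? (b ≟_) (endpoints M)) (augment k matching refl x∉ path zb)
        where
        augment : ∀ k {M x z b} → IsMatching H M → length M ≡ m → x ∉ endpoints M →
          Alternating M k x z → H z b → ¬ b ∉ endpoints M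
        augment k {M} {x} {b = b} (hs , uniq) len x∉ stop xb b∉ =
          1+n≰n (subst (λ j → suc j ≤ m) len (maximum ((x , b) ∷ M)
            (xb ∷ hs , (x≢b ∷ All.¬Any⇒All¬ _ x∉) ∷ All.¬Any⇒All¬ _ b∉ ∷ uniq)))
          where
          x≢b : x ≢ b
          x≢b refl = bipartite xb refl
        augment (suc k) {M} {x} {z} {b} matching len x∉ (step {b = c} {l = l} xc cl p) zb b∉ =
          augment k isMatching (trans length-M′ len) l∉M′ path′ zb b∉M′
          where
          open Flip M matching x∉ xc cl
          path′ : Alternating M′ k l z
          path′ = [ id , id ]′ (transfer refl p)
          path-colour : ∀ {k x z} → Alternating M k x z → colour x ≡ colour z
          path-colour stop          = refl
          path-colour (step xc e p) = trans (same-colour xc (edgeGraph-⊆ H-sym (proj₁ matching) e)) (path-colour p)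
          -- The flip newly covers only `x`. This cannot be `b`, since `z` has the colour of `x` and
          -- is adjacent to `b`.
          b∉M′ : b ∉ endpoints M′
          b∉M′ b∈ with endpoints-M′ b∈
          ... | inj₁ refl      = bipartite zb (sym (path-colour (step xc cl p)))
          ... | inj₂ (b∈M , _) = b∉ b∈M

      -- Reachability is not decided; the cover exists up to double negation, which is enough for the
      -- decidable inequalities it is used for.
      cover : ∀ M → IsMatching H M → length M ≡ m →
        ¬ ¬ ∃ λ (y : Fin n → ℕ) → (∀ u v → H u v → 1 ≤ y u + y v) × ∑ (allFin n) y ≤ m
      cover M matching len ¬cover =
        ¬¬-∀Fin (λ v → Dec (Covering v)) (λ _ → ¬¬-excluded-middle) λ dec → ¬cover (construct dec)
        where
        Reached : Fin n → Set
        Reached z = ∃ λ x → ∃ λ k → colour x ≡ true × x ∉ endpoints M × Alternating M k x z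

        -- Kőnig's cover: the unreached vertices on the `true` side and the reached ones on the
        -- `false` side. A `false` vertex counts as reached through its mate, so `Reached` concerns
        -- only `true` vertices.
        Covering : Fin n → Set
        Covering v = (colour v ≡ true × ¬ Reached v)
                   ⊎ (colour v ≡ false × ∃ λ l → edgeGraph M v l × Reached l)

        -- If `u` is reached, then `v` is matched, as otherwise the path would augment. One more
        -- step reaches the mate of `v`, which puts `v` into the cover.
        covers : ∀ {u v} → colour u ≡ true → H u v → ¬ Covering u → ¬ ¬ Covering v
        covers {u} {v} ut uv ¬u ¬v = ¬u (inj₁ (ut , λ where
          (x , k , xt , x∉ , p) → case ∈-endpoints⁻ M (no-augmenting-path k matching len x∉ p uv) of λ where
            (l , vl) → ¬v (inj₂ (trans (¬-not (bipartite (H-sym uv))) (cong not ut) , l , vl , x , suc k , xt , x∉ , extend-alternating p uv vl))))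

        endpoint : ∀ {v} → Covering v → v ∈ endpoints M
        endpoint {v} (inj₁ (vt , ¬r)) = decidable-stable (any? (v ≟_) (endpoints M)) λ v∉ →
          ¬r (v , 0 , vt , v∉ , stop)
        endpoint (inj₂ (_ , l , vl , _)) = ∈-endpoints⁺ vl

        matched-once : ∀ {u v} → edgeGraph M u v → Covering u → ¬ Covering v
        matched-once e (inj₁ (ut , _)) (inj₁ (vt , _)) =
          bipartite (edgeGraph-⊆ H-sym (proj₁ matching) e) (trans ut (sym vt))
        matched-once e (inj₁ (ut , ¬r)) (inj₂ (_ , l , vl , r))
          rewrite mate-unique M (proj₂ matching) (edgeGraph-sym M e) vl = ¬r r
        matched-once e (inj₂ (_ , l , ul , r)) (inj₁ (vt , ¬r))
          rewrite mate-unique M (proj₂ matching) e ul = ¬r r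
        matched-once e (inj₂ (uf , _)) (inj₂ (vf , _)) =
          bipartite (edgeGraph-⊆ H-sym (proj₁ matching) e) (trans uf (sym vf))

        construct : (∀ v → Dec (Covering v)) →
          ∃ λ (y : Fin n → ℕ) → (∀ u v → H u v → 1 ≤ y u + y v) × ∑ (allFin n) y ≤ m
        construct dec = y , y-cover , total
          where
          y : Fin n → ℕ
          y v = if ⌊ dec v ⌋ then 1 else 0
          y-cover : ∀ u v → H u v → 1 ≤ y u + y v
          y-cover u v uv with dec u | dec v
          ... | yes _ | _     = s≤s z≤n
          ... | no _  | yes _ = ≤-refl
          ... | no ¬u | no ¬v with colour u Bool.≟ true
          ... | yes ut = contradiction ¬v (covers ut uv ¬u)
          ... | no ¬ut = contradiction ¬u
            (covers (trans (¬-not (bipartite (H-sym uv))) (cong not (¬-not ¬ut))) (H-sym uv) ¬v)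
          y≤deg : ∀ v → y v ≤ y v * deg M v
          y≤deg v with dec v
          ... | yes c = ≤-trans (∈⇒1≤deg M (endpoint c)) (≤-reflexive (sym (+-identityʳ _)))
          ... | no _  = z≤n
          y-edge : ∀ {u v} → edgeGraph M u v → y u + y v ≤ 1
          y-edge {u} {v} e with dec u | dec v
          ... | yes c | yes d = contradiction d (matched-once e c)
          ... | yes _ | no _  = ≤-refl
          ... | no _  | yes _ = ≤-refl
          ... | no _  | no _  = z≤n
          total : ∑ (allFin n) y ≤ m
          -- Cover vertices are matched, so the factor `deg M v` costs nothing; each edge of `M`
          -- contains at most one of them.
          total = begin
            ∑ (allFin n) y                          ≤⟨ ∑-mono (allFin n) (λ {v} _ → y≤deg v) ⟩
            ∑ (allFin n) (λ v → y v * deg M v)      ≡⟨ handshake-deg M y ⟩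
            ∑ₑ M (λ u v → y u + y v)                ≤⟨ ∑-mono M (λ e∈ → y-edge (inj₁ e∈)) ⟩
            ∑ M (λ _ → 1)                           ≡⟨ ∑-const 1 M ⟩
            length M * 1                            ≡⟨ *-identityʳ _ ⟩
            length M                                ≡⟨ len ⟩
            m                                       ∎
            where open ≤-Reasoning

  -- The bipartition and a single assignment

  occursFst-∈ : {M : Edges n} {a b : Fin n} → (a , b) ∈ M → occursFst M a ≡ true
  occursFst-∈ {a = a} (here refl) with a ≟ a
  ... | yes _  = refl
  ... | no a≢a = contradiction refl a≢a
  occursFst-∈ {M = (p , _) ∷ _} {a} (there e∈) with p ≟ a
  ... | yes _ = refl
  ... | no _  = occursFst-∈ e∈

  occursSnd-∈ : {M : Edges n} {a b : Fin n} → (a , b) ∈ M → occursSnd M b ≡ true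
  occursSnd-∈ {b = b} (here refl) with b ≟ b
  ... | yes _  = refl
  ... | no b≢b = contradiction refl b≢b
  occursSnd-∈ {M = (_ , q) ∷ _} {b = b} (there e∈) with q ≟ b
  ... | yes _ = refl
  ... | no _  = occursSnd-∈ e∈

  occursFst-∉ : (M : Edges n) {v : Fin n} → v ∉ endpoints M → occursFst M v ≡ false
  occursFst-∉ []            v∉ = refl
  occursFst-∉ ((p , q) ∷ M) {v} v∉ with p ≟ v
  ... | yes refl = contradiction (here refl) v∉
  ... | no _     = occursFst-∉ M (v∉ ∘ there ∘ there)

  occursSnd-∉ : (M : Edges n) {v : Fin n} → v ∉ endpoints M → occursSnd M v ≡ false
  occursSnd-∉ []            v∉ = refl
  occursSnd-∉ ((p , q) ∷ M) {v} v∉ with q ≟ v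
  ... | yes refl = contradiction (there (here refl)) v∉
  ... | no _     = occursSnd-∉ M (v∉ ∘ there ∘ there)

  occursFst-snd : (M : Edges n) → Unique (endpoints M) → {a b : Fin n} → (a , b) ∈ M → occursFst M b ≡ false
  occursFst-snd ((p , q) ∷ M) ((p≢q ∷ _) ∷ q∉ ∷ _) (here refl) with p ≟ q
  ... | yes p≡q = contradiction p≡q p≢q
  ... | no _    = occursFst-∉ M (All.All¬⇒¬Any q∉)
  occursFst-snd ((p , q) ∷ M) ((_ ∷ p∉) ∷ _ ∷ uniq) {b = b} (there e∈) with p ≟ b
  ... | yes refl = contradiction (∈-endpoints⁺ (inj₂ e∈)) (All.All¬⇒¬Any p∉)
  ... | no _     = occursFst-snd M uniq e∈

  occurs-∈ : (M : Edges n) {v : Fin n} → v ∈ endpoints M → occursFst M v ∨ occursSnd M v ≡ true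
  occurs-∈ M v∈ with ∈-endpoints⁻ M v∈
  ... | _ , inj₁ e∈ rewrite occursFst-∈ e∈ = refl
  ... | _ , inj₂ e∈ rewrite occursSnd-∈ e∈ = ∨-zeroʳ _

  side-fst : (M : Edges n) (σ : Fin n → Bool) {a b : Fin n} → (a , b) ∈ M → side M σ a ≡ true
  side-fst M σ e∈ rewrite occursFst-∈ e∈ = refl

  side-snd : (M : Edges n) → Unique (endpoints M) → (σ : Fin n → Bool) {a b : Fin n} →
    (a , b) ∈ M → side M σ b ≡ false
  side-snd M uniq σ e∈ rewrite occursFst-snd M uniq e∈ | occursSnd-∈ e∈ = refl

  side-∉ : (M : Edges n) (σ : Fin n → Bool) {v : Fin n} → v ∉ endpoints M → side M σ v ≡ σ v
  side-∉ M σ v∉ rewrite occursFst-∉ M v∉ | occursSnd-∉ M v∉ = refl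

  -- The sides of matched vertices are fixed before any coin is tossed. In the average only the free
  -- vertices are random, and a constant assignment can stand for `σ` at the matched ones.
  side-∈ : (M : Edges n) (σ τ : Fin n → Bool) {v : Fin n} → v ∈ endpoints M → side M σ v ≡ side M τ v
  side-∈ M σ τ v∈ with ∈-endpoints⁻ M v∈
  ... | _ , inj₁ e∈ rewrite occursFst-∈ e∈ = refl
  ... | _ , inj₂ e∈ rewrite occursSnd-∈ e∈ = refl

  capacity-∈ : (b : ℕ) (M : Edges n) {v : Fin n} → v ∈ endpoints M → capacity b M v ≡ 1
  capacity-∈ b M v∈ rewrite occurs-∈ M v∈ = refl

  capacity-∉ : (b : ℕ) (M : Edges n) {v : Fin n} → v ∉ endpoints M → capacity b M v ≡ b
  capacity-∉ b M v∉ rewrite occursFst-∉ M v∉ | occursSnd-∉ M v∉ = refl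

  bit : Bool → ℕ
  bit b = if b then 1 else 0

  bit≤1 : ∀ b → bit b ≤ 1
  bit≤1 true  = ≤-refl
  bit≤1 false = z≤n

  free : Edges n → Fin n → ℕ
  free M v = 1 ∸ deg M v

  free-∉ : (M : Edges n) {v : Fin n} → v ∉ endpoints M → free M v ≡ 1
  free-∉ M v∉ = cong (1 ∸_) (∉⇒deg≡0 M v∉)

  free-∈ : (M : Edges n) {v : Fin n} → v ∈ endpoints M → free M v ≡ 0
  free-∈ M v∈ = m≤n⇒m∸n≡0 (∈⇒1≤deg M v∈)

  crossing : Edges n → (Fin n → Bool) → Fin n → Fin n → ℕ
  crossing M σ x y = free M y * bit (side M σ x xor side M σ y)

  crossing≤1 : (M : Edges n) (σ : Fin n → Bool) (x y : Fin n) → crossing M σ x y ≤ 1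
  crossing≤1 M σ x y = *-mono-≤ (m∸n≤m 1 (deg M y)) (bit≤1 (side M σ x xor side M σ y))

  -- For a vertex v of the first matching M, the number (0 or 1) of edges of the optimal matching M⋆
  -- that join v to a vertex free in M on the other side.
  wing : Edges n → Edges n → (Fin n → Bool) → Fin n → ℕ
  wing M⋆ M σ = incidence M⋆ (crossing M σ)

  private
    -- This is (1 - a)(1 - b) ≥ 0, expanded.
    edge-product : ∀ {a b} → a ≤ 1 → b ≤ 1 → a + b ≤ 1 + a * b
    edge-product z≤n       b≤1 = b≤1
    edge-product {b = b} (s≤s z≤n) b≤1 = s≤s (≤-reflexive (sym (+-identityʳ b)))

    -- Here `p`, `q` indicate the wings at the two ends of an M₁-edge, and `a`, `b` whether M₂ meets
    -- these ends. A path whose middle edge is not met twice has a wing at a missed end.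
    uncovered-wing : ∀ {p q a b} → p ≤ 1 → q ≤ 1 → a ≤ 1 → b ≤ 1 →
      p * q ≤ a * b + (p * (1 ∸ a) + q * (1 ∸ b))
    uncovered-wing z≤n       q≤1       a≤1       b≤1       = z≤n
    uncovered-wing (s≤s z≤n) z≤n       a≤1       b≤1       = z≤n
    uncovered-wing (s≤s z≤n) (s≤s z≤n) z≤n       b≤1       = s≤s z≤n
    uncovered-wing (s≤s z≤n) (s≤s z≤n) (s≤s z≤n) z≤n       = s≤s z≤n
    uncovered-wing (s≤s z≤n) (s≤s z≤n) (s≤s z≤n) (s≤s z≤n) = s≤s z≤n

    -- The factors `1` are what `saturated` leaves of `d u`, the crossing indicator and `o v` after
    -- rewriting.
    saturation : ∀ {a b} → ¬ (a < 1 × b < 9) → 9 * ((1 ∸ a) * 1) * 1 ≤ 1 * b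
    saturation {zero}  {b} ¬p = ≤-trans (≮⇒≥ λ b<9 → ¬p (s≤s z≤n , b<9)) (≤-reflexive (sym (+-identityʳ b)))
    saturation {suc a} ¬p rewrite 0∸n≡0 a = z≤n

    -- `y`, `z` are the cover values at the ends of an M₁-edge and `a`, `b` their M₂-degrees. An
    -- edge covered at one end pays 9, and the extra unit is owed by the M₂-edge at the uncovered
    -- end. An edge covered at both ends pays 18 and needs no help.
    edge-weight : ∀ y z {a b} → 1 ≤ y + z → a ≤ 1 → b ≤ 1 →
      9 + a * b ≤ (y * 9 + z * 9) + ((1 ∸ y) * a + (1 ∸ z) * b)
    edge-weight zero    (suc z) {a} _ a≤1 b≤1 = begin
      9 + a * _                    ≤⟨ +-monoʳ-≤ 9 (*-monoʳ-≤ a b≤1) ⟩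
      9 + a * 1                    ≡⟨ cong (9 +_) (*-comm a 1) ⟩
      9 + 1 * a                    ≤⟨ +-mono-≤ (m≤m+n 9 (z * 9)) (m≤m+n (1 * a) _) ⟩
      suc z * 9 + (1 * a + _)      ∎
      where open ≤-Reasoning
    edge-weight (suc y) zero    {a} {b} _ a≤1 b≤1 = begin
      9 + a * b                    ≤⟨ +-monoʳ-≤ 9 (*-monoˡ-≤ b a≤1) ⟩
      9 + 1 * b                    ≤⟨ +-monoˡ-≤ (1 * b) (≤-trans (m≤m+n 9 (y * 9)) (≤-reflexive (sym (+-identityʳ _)))) ⟩
      (suc y * 9 + 0) + 1 * b      ≤⟨ +-monoʳ-≤ (suc y * 9 + 0) (m≤n+m (1 * b) ((0 ∸ y) * a)) ⟩
      (suc y * 9 + 0) + ((0 ∸ y) * a + 1 * b) ∎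
      where open ≤-Reasoning
    edge-weight (suc y) (suc z) {a} {b} _ a≤1 b≤1 = begin
      9 + a * b                    ≤⟨ +-monoʳ-≤ 9 (*-mono-≤ a≤1 b≤1) ⟩
      10                           ≤⟨ m≤m+n 10 8 ⟩
      9 + 9                        ≤⟨ +-mono-≤ (m≤m+n 9 (y * 9)) (m≤m+n 9 (z * 9)) ⟩
      suc y * 9 + suc z * 9        ≤⟨ m≤m+n _ _ ⟩
      suc y * 9 + suc z * 9 + _    ∎
      where open ≤-Reasoning

    -- Ten times the first hypothesis plus the other two; `t` and `x` cancel.
    eliminate : ∀ k q t x m → 9 * k + t ≤ 9 * m → x ≤ k + t → 9 * q ≤ 9 * t + x →
      89 * k + 9 * q ≤ 90 * m
    eliminate k q t x m a b c = +-cancelʳ-≤ (k + 10 * t + x) _ _ (begin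
      89 * k + 9 * q + (k + 10 * t + x)             ≡⟨ left k q t x ⟩
      10 * (9 * k + t) + (x + 9 * q)                ≤⟨ +-mono-≤ (*-monoʳ-≤ 10 a) (+-mono-≤ b c) ⟩
      10 * (9 * m) + ((k + t) + (9 * t + x))        ≡⟨ right k t x m ⟩
      90 * m + (k + 10 * t + x)                     ∎)
      where
      open ≤-Reasoning
      left : ∀ k q t x → 89 * k + 9 * q + (k + 10 * t + x) ≡ 10 * (9 * k + t) + (x + 9 * q)
      left = solve-∀
      right : ∀ k t x m → 10 * (9 * m) + ((k + t) + (9 * t + x)) ≡ 90 * m + (k + 10 * t + x)
      right = solve-∀

  -- The deterministic bound for one assignment

  module Bipartition {n : ℕ} (G : Graph n) (M₁ M⋆ : Edges n)
    (matching₁ : IsMatching (Adj G) M₁) (matching⋆ : IsMatching (Adj G) M⋆)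
    (σ : Fin n → Bool) (M₂ : Edges n) (maximal₂ : IsMaximalBMatching (E₂ G M₁ σ) (capacity 9 M₁) M₂) where

    private
      V : List (Fin n)
      V = allFin n
      d D o w : Fin n → ℕ
      d = deg M₁
      D = deg M₂
      o = free M₁
      w = wing M⋆ M₁ σ
      k = length M₁
      x = length M₂
      q = ∑ₑ M₁ (λ u v → w u * w v)
      t = ∑ₑ M₁ (λ u v → D u * D v)

      inner? : ∀ v → Dec (v ∈ endpoints M₁)
      inner? v = any? (v ≟_) (endpoints M₁)

      D≤1 : ∀ {v} → v ∈ endpoints M₁ → D v ≤ 1
      D≤1 v∈ = subst (D _ ≤_) (capacity-∈ 9 M₁ v∈) (proj₂ (proj₁ maximal₂) _)

      D≤9 : ∀ {v} → v ∉ endpoints M₁ → D v ≤ 9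
      D≤9 v∉ = subst (D _ ≤_) (capacity-∉ 9 M₁ v∉) (proj₂ (proj₁ maximal₂) _)

      fst∈ : ∀ {e} → e ∈ M₁ → proj₁ e ∈ endpoints M₁
      fst∈ e∈ = ∈-endpoints⁺ (inj₁ e∈)

      snd∈ : ∀ {e} → e ∈ M₁ → proj₂ e ∈ endpoints M₁
      snd∈ e∈ = ∈-endpoints⁺ (inj₂ e∈)

      w≤1 : ∀ v → w v ≤ 1
      w≤1 v = ≤-trans (incidence≤deg M⋆ (crossing≤1 M₁ σ) v) (unique⇒deg≤1 M⋆ (proj₂ matching⋆) v)

    d-E₂ : ∀ {u v} → E₂ G M₁ σ u v → d u + d v ≡ 1
    d-E₂ (inj₁ (_ , u∈ , v∉ , _)) = cong₂ _+_ (∈⇒deg≡1 M₁ (proj₂ matching₁) u∈) (∉⇒deg≡0 M₁ v∉)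
    d-E₂ (inj₂ (_ , v∈ , u∉ , _)) = cong₂ _+_ (∉⇒deg≡0 M₁ u∉) (∈⇒deg≡1 M₁ (proj₂ matching₁) v∈)

    o-E₂ : ∀ {u v} → E₂ G M₁ σ u v → o u + o v ≡ 1
    o-E₂ (inj₁ (_ , u∈ , v∉ , _)) = cong₂ _+_ (free-∈ M₁ u∈) (free-∉ M₁ v∉)
    o-E₂ (inj₂ (_ , v∈ , u∉ , _)) = cong₂ _+_ (free-∉ M₁ u∉) (free-∈ M₁ v∈)

    -- Every M₂-edge has exactly one inner and one outer end. So M₂ may be counted at its inner ends
    -- (`f = d`) or at its outer ends (`f = o`).
    weight-length : (f : Fin n → ℕ) → (∀ {u v} → E₂ G M₁ σ u v → f u + f v ≡ 1) →
      ∑ V (λ v → f v * D v) ≡ x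
    weight-length f f-E₂ =
      trans (handshake-deg M₂ f)
     (trans (∑-cong M₂ λ e∈ → f-E₂ (All.lookup (proj₁ (proj₁ maximal₂)) e∈))
     (trans (∑-const 1 M₂) (*-identityʳ x)))

    -- Inner vertices have capacity 1, so |M₂| counts the met inner ends: at most one per M₁-edge,
    -- and a second one exactly at the edges counted by `t`.
    M₂-edges : x ≤ k + t
    M₂-edges = begin
      x                                ≡⟨ weight-length d d-E₂ ⟨
      ∑ V (λ v → d v * D v)            ≡⟨ ∑-cong V (λ {v} _ → *-comm (d v) (D v)) ⟩
      ∑ V (λ v → D v * d v)            ≡⟨ handshake-deg M₁ D ⟩
      ∑ₑ M₁ (λ u v → D u + D v)        ≤⟨ ∑-mono M₁ (λ e∈ → edge-product (D≤1 (fst∈ e∈)) (D≤1 (snd∈ e∈))) ⟩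
      ∑ₑ M₁ (λ u v → 1 + D u * D v)    ≡⟨ ∑-+ M₁ (λ _ → 1) _ ⟩
      ∑ M₁ (λ _ → 1) + t               ≡⟨ cong (_+ t) (trans (∑-const 1 M₁) (*-identityʳ k)) ⟩
      k + t                            ∎
      where open ≤-Reasoning

    maximal : ∀ {u v} → Adj G u v → u ∈ endpoints M₁ → v ∉ endpoints M₁ →
      side M₁ σ u ≢ side M₁ σ v → ¬ (D u < 1 × D v < 9)
    maximal uv u∈ v∉ u≢v (Du<1 , Dv<9) = proj₂ maximal₂ _ _ (inj₁ (uv , u∈ , v∉ , u≢v))
      ( subst (D _ <_) (sym (capacity-∈ 9 M₁ u∈)) Du<1
      , subst (D _ <_) (sym (capacity-∉ 9 M₁ v∉)) Dv<9 )

    -- If M₂ misses the inner end u of a crossing edge, maximality forces its outer end v to be saturated.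
    saturated : ∀ {u v} → Adj G u v → 9 * ((1 ∸ D u) * d u) * crossing M₁ σ u v ≤ o v * D v
    saturated {u} {v} uv with inner? u | inner? v
    ... | no u∉ | _ rewrite ∉⇒deg≡0 M₁ u∉ | *-zeroʳ (1 ∸ D u) = z≤n
    ... | yes _ | yes v∈ rewrite free-∈ M₁ v∈ | *-zeroʳ (9 * ((1 ∸ D u) * d u)) = z≤n
    ... | yes u∈ | no v∉ rewrite free-∉ M₁ v∉ | ∈⇒deg≡1 M₁ (proj₂ matching₁) u∈
        with side M₁ σ u in su | side M₁ σ v in sv
    ... | true  | true  = ≤-trans (≤-reflexive (*-zeroʳ (9 * ((1 ∸ D u) * 1)))) z≤n
    ... | false | false = ≤-trans (≤-reflexive (*-zeroʳ (9 * ((1 ∸ D u) * 1)))) z≤n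
    ... | true  | false = saturation (maximal uv u∈ v∉ λ eq → case trans (sym su) (trans eq sv) of λ ())
    ... | false | true  = saturation (maximal uv u∈ v∉ λ eq → case trans (sym su) (trans eq sv) of λ ())

    -- Each wing at a missed inner end is charged, with weight 9, to the M₂-edges at its saturated
    -- outer vertex. Since M⋆ is a matching, an outer vertex is charged for at most one wing, so the
    -- charges total at most |M₂|.
    missed-wings : 9 * q ≤ 9 * t + x
    missed-wings = begin
      9 * q                                         ≤⟨ *-monoʳ-≤ 9 (∑-mono M₁ λ {e} e∈ →
                                                         uncovered-wing (w≤1 (proj₁ e)) (w≤1 (proj₂ e)) (D≤1 (fst∈ e∈)) (D≤1 (snd∈ e∈))) ⟩
      9 * ∑ₑ M₁ (λ u v → D u * D v + (m u + m v))   ≡⟨ cong (9 *_) (∑-+ M₁ _ _) ⟩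
      9 * (t + ∑ₑ M₁ (λ u v → m u + m v))           ≡⟨ *-distribˡ-+ 9 t _ ⟩
      9 * t + 9 * ∑ₑ M₁ (λ u v → m u + m v)         ≡⟨ cong (λ s → 9 * t + 9 * s) (handshake-deg M₁ m) ⟨
      9 * t + 9 * ∑ V (λ v → m v * d v)             ≡⟨ cong (9 * t +_) (∑-* 9 V _) ⟨
      9 * t + ∑ V (λ v → 9 * (m v * d v))           ≡⟨ cong (9 * t +_) (∑-cong V λ {v} _ → shuffle (w v) (1 ∸ D v) (d v)) ⟩
      9 * t + ∑ V (λ v → 9 * ((1 ∸ D v) * d v) * w v) ≡⟨ cong (9 * t +_) (handshake M⋆ (λ v → 9 * ((1 ∸ D v) * d v)) (crossing M₁ σ)) ⟩
      9 * t + ∑ₑ M⋆ (λ u v → 9 * ((1 ∸ D u) * d u) * crossing M₁ σ u v + 9 * ((1 ∸ D v) * d v) * crossing M₁ σ v u)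
        ≤⟨ +-monoʳ-≤ (9 * t) (∑-mono M⋆ λ {e} e∈ →
             +-mono-≤ (saturated (All.lookup (proj₁ matching⋆) e∈)) (saturated (symm G (All.lookup (proj₁ matching⋆) e∈)))) ⟩
      9 * t + ∑ₑ M⋆ (λ u v → o v * D v + o u * D u) ≡⟨ cong (9 * t +_) (∑-cong M⋆ λ {e} _ → +-comm (o (proj₂ e) * D (proj₂ e)) _) ⟩
      9 * t + ∑ₑ M⋆ (λ u v → o u * D u + o v * D v) ≡⟨ cong (9 * t +_) (handshake-deg M⋆ (λ v → o v * D v)) ⟨
      9 * t + ∑ V (λ v → o v * D v * deg M⋆ v)      ≤⟨ +-monoʳ-≤ (9 * t) (∑-mono V λ {v} _ →
                                                         ≤-trans (*-monoʳ-≤ (o v * D v) (unique⇒deg≤1 M⋆ (proj₂ matching⋆) v)) (≤-reflexive (*-identityʳ _))) ⟩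
      9 * t + ∑ V (λ v → o v * D v)                 ≡⟨ cong (9 * t +_) (weight-length o o-E₂) ⟩
      9 * t + x                                     ∎
      where
      open ≤-Reasoning
      m : Fin n → ℕ
      m v = w v * (1 ∸ D v)
      shuffle : ∀ a b c → 9 * (a * b * c) ≡ 9 * (b * c) * a
      shuffle = solve-∀

    -- The edges of M₁ with both ends met by M₂ give augmenting paths of length 3, which can share
    -- their outer ends up to 9 times: each one counts for 1/9.
    cover-weight : (y : Fin n → ℕ) → (∀ u v → edgeGraph (M₁ ++ M₂) u v → 1 ≤ y u + y v) →
      9 * k + t ≤ 9 * ∑ V y
    cover-weight y covers = begin
      9 * k + t                                     ≡⟨ cong (_+ t) (trans (*-comm 9 k) (sym (∑-const 9 M₁))) ⟩
      ∑ M₁ (λ _ → 9) + t                            ≡⟨ ∑-+ M₁ _ _ ⟨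
      ∑ₑ M₁ (λ u v → 9 + D u * D v)                 ≤⟨ ∑-mono M₁ (λ {e} e∈ →
                                                         edge-weight (y (proj₁ e)) (y (proj₂ e)) (covers _ _ (inj₁ (∈-++⁺ˡ e∈))) (D≤1 (fst∈ e∈)) (D≤1 (snd∈ e∈))) ⟩
      ∑ₑ M₁ (λ u v → (y u * 9 + y v * 9) + (z u * D u + z v * D v)) ≡⟨ ∑-+ M₁ _ _ ⟩
      ∑ₑ M₁ (λ u v → y u * 9 + y v * 9) + ∑ₑ M₁ (λ u v → z u * D u + z v * D v)
        ≡⟨ cong₂ _+_ (handshake-deg M₁ (λ v → y v * 9)) (handshake-deg M₁ (λ v → z v * D v)) ⟨
      inner + ∑ V (λ v → z v * D v * d v)           ≡⟨ cong (inner +_) (∑-cong V λ {v} _ → shuffle (z v) (D v) (d v)) ⟩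
      inner + ∑ V (λ v → d v * z v * D v)           ≡⟨ cong (inner +_) (handshake-deg M₂ (λ v → d v * z v)) ⟩
      inner + ∑ₑ M₂ (λ u v → d u * z u + d v * z v) ≤⟨ +-monoʳ-≤ inner (∑-mono M₂ λ {e} e∈ →
                                                         outer (All.lookup (proj₁ (proj₁ maximal₂)) e∈) (covers _ _ (inj₁ (∈-++⁺ʳ M₁ e∈)))) ⟩
      inner + ∑ₑ M₂ (λ u v → o u * y u + o v * y v) ≡⟨ cong (inner +_) (handshake-deg M₂ (λ v → o v * y v)) ⟨
      inner + ∑ V (λ v → o v * y v * D v)           ≡⟨ ∑-+ V _ _ ⟨
      ∑ V (λ v → y v * 9 * d v + o v * y v * D v)   ≤⟨ ∑-mono V (λ {v} _ → vertex v) ⟩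
      ∑ V (λ v → 9 * y v)                           ≡⟨ ∑-* 9 V y ⟩
      9 * ∑ V y                                     ∎
      where
      open ≤-Reasoning
      z : Fin n → ℕ
      z v = 1 ∸ y v
      inner : ℕ
      inner = ∑ V (λ v → y v * 9 * d v)
      shuffle : ∀ a b c → a * b * c ≡ c * a * b
      shuffle = solve-∀
      complement : ∀ {a b} → 1 ≤ a + b → 1 ∸ a ≤ b
      complement {zero}  p = p
      complement {suc a} p = ≤-trans (≤-reflexive (0∸n≡0 a)) z≤n
      -- An M₂-edge whose inner end is uncovered is covered at its outer end, so the debt moves
      -- there.
      outer : ∀ {u v} → E₂ G M₁ σ u v → 1 ≤ y u + y v → d u * z u + d v * z v ≤ o u * y u + o v * y v
      outer {u} {v} (inj₁ (_ , u∈ , v∉ , _)) p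
        rewrite ∈⇒deg≡1 M₁ (proj₂ matching₁) u∈ | ∉⇒deg≡0 M₁ v∉
              | +-identityʳ (z u) | +-identityʳ (z u) | +-identityʳ (y v) = complement p
      outer {u} {v} (inj₂ (_ , v∈ , u∉ , _)) p
        rewrite ∈⇒deg≡1 M₁ (proj₂ matching₁) v∈ | ∉⇒deg≡0 M₁ u∉
              | +-identityʳ (z v) | +-identityʳ (y u) | +-identityʳ (y u) = complement (subst (1 ≤_) (+-comm (y u) (y v)) p)
      -- Inner vertices pay only the first term and outer ones only the second. Capacity 9 keeps the
      -- debt of an outer vertex within `9 * y v`.
      vertex : ∀ v → y v * 9 * d v + o v * y v * D v ≤ 9 * y v
      vertex v with inner? v
      ... | yes v∈ rewrite ∈⇒deg≡1 M₁ (proj₂ matching₁) v∈ =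
        ≤-reflexive (trans (+-identityʳ _) (trans (*-identityʳ _) (*-comm (y v) 9)))
      ... | no v∉ rewrite ∉⇒deg≡0 M₁ v∉ | *-zeroʳ (y v * 9) =
        ≤-trans (*-mono-≤ (≤-reflexive (+-identityʳ (y v))) (D≤9 v∉)) (≤-reflexive (*-comm (y v) 9))

    union-bipartite : ∀ {u v} → edgeGraph (M₁ ++ M₂) u v → side M₁ σ u ≢ side M₁ σ v
    union-bipartite = λ { (inj₁ e∈) → edge e∈ ; (inj₂ e∈) → edge e∈ ∘ sym }
      where
      edge : ∀ {u v} → (u , v) ∈ M₁ ++ M₂ → side M₁ σ u ≢ side M₁ σ v
      edge e∈ eq with ∈-++⁻ M₁ e∈
      ... | inj₁ e∈₁ = case trans (sym (side-fst M₁ σ e∈₁)) (trans eq (side-snd M₁ (proj₂ matching₁) σ e∈₁)) of λ ()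
      ... | inj₂ e∈₂ with All.lookup (proj₁ (proj₁ maximal₂)) e∈₂
      ... | inj₁ (_ , _ , _ , u≢v) = u≢v eq
      ... | inj₂ (_ , _ , _ , v≢u) = v≢u (sym eq)

    μ-lower-bound : ∀ {m} → IsMu (edgeGraph (M₁ ++ M₂)) m → 89 * k + 9 * q ≤ 90 * m
    μ-lower-bound {m} ((M , matching , len) , maximum) = decidable-stable (_ ≤? _) λ ¬bound →
      Kőnig.cover _ (edgeGraph-sym (M₁ ++ M₂)) (side M₁ σ) union-bipartite maximum M matching len
        λ { (y , covers , ∑y≤m) → ¬bound (eliminate k q t x m
              (≤-trans (cover-weight y covers) (*-monoʳ-≤ 9 ∑y≤m)) M₂-edges missed-wings) }

  -- Averaging over all assignments

  ∑-allAssign-suc : (X : (Fin (suc n) → Bool) → ℕ) →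
    ∑ (allAssign (suc n)) X ≡ ∑ (allAssign n) (λ σ → X (extend false σ) + X (extend true σ))
  ∑-allAssign-suc {n} X = go (allAssign n)
    where
    go : ∀ σs → ∑ (concatMap (λ σ → extend false σ ∷ extend true σ ∷ []) σs) X
              ≡ ∑ σs (λ σ → X (extend false σ) + X (extend true σ))
    go []       = refl
    go (σ ∷ σs) = trans (sym (+-assoc (X (extend false σ)) _ _)) (cong (X (extend false σ) + X (extend true σ) +_) (go σs))

  ∑-allAssign-const : ∀ n c → ∑ (allAssign n) (λ _ → c) ≡ 2 ^ n * c
  ∑-allAssign-const zero    c = refl
  ∑-allAssign-const (suc n) c = begin
    ∑ (allAssign (suc n)) (λ _ → c)    ≡⟨ ∑-allAssign-suc {n} (λ _ → c) ⟩
    ∑ (allAssign n) (λ _ → c + c)      ≡⟨ ∑-allAssign-const n (c + c) ⟩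
    2 ^ n * (c + c)                    ≡⟨ double (2 ^ n) c ⟩
    2 ^ suc n * c                      ∎
    where
    open ≡-Reasoning
    double : ∀ p c → p * (c + c) ≡ (p + (p + 0)) * c
    double = solve-∀

  bit-xor-total : ∀ s → bit (s xor false) + bit (s xor true) ≡ 1
  bit-xor-total true  = refl
  bit-xor-total false = refl

  ∑-one-coin : ∀ {n} (s : Bool) (a : Fin n) → 2 * ∑ (allAssign n) (λ σ → bit (s xor σ a)) ≡ 2 ^ n
  ∑-one-coin {suc n} s F.zero = cong (2 *_) (begin
    ∑ (allAssign (suc n)) (λ σ → bit (s xor σ F.zero))                ≡⟨ ∑-allAssign-suc {n} _ ⟩
    ∑ (allAssign n) (λ _ → bit (s xor false) + bit (s xor true))      ≡⟨ ∑-cong (allAssign n) (λ _ → bit-xor-total s) ⟩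
    ∑ (allAssign n) (λ _ → 1)                                         ≡⟨ ∑-allAssign-const n 1 ⟩
    2 ^ n * 1                                                         ≡⟨ *-identityʳ (2 ^ n) ⟩
    2 ^ n                                                             ∎)
    where open ≡-Reasoning
  ∑-one-coin {suc n} s (F.suc a) = cong (2 *_) (begin
    ∑ (allAssign (suc n)) (λ σ → bit (s xor σ (F.suc a)))             ≡⟨ ∑-allAssign-suc {n} _ ⟩
    ∑ (allAssign n) (λ σ → bit (s xor σ a) + bit (s xor σ a))         ≡⟨ ∑-+ (allAssign n) _ _ ⟩
    p + p                                                             ≡⟨ cong (p +_) (+-identityʳ p) ⟨
    2 * p                                                             ≡⟨ ∑-one-coin s a ⟩
    2 ^ n                                                             ∎)
    where
    open ≡-Reasoning
    p : ℕ
    p = ∑ (allAssign n) (λ σ → bit (s xor σ a))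

  -- Common coordinates are stripped until one of the two coins is the first coordinate. Its two
  -- outcomes add up to 1 and leave a single coin.
  ∑-two-coins : ∀ {n} (s t : Bool) {a c : Fin n} → a ≢ c →
    4 * ∑ (allAssign n) (λ σ → bit (s xor σ a) * bit (t xor σ c)) ≡ 2 ^ n
  ∑-two-coins {suc n} s t {F.zero}  {F.zero}  a≢c = contradiction refl a≢c
  ∑-two-coins {suc n} s t {F.zero}  {F.suc c} a≢c = begin
    4 * ∑ (allAssign (suc n)) (λ σ → bit (s xor σ F.zero) * bit (t xor σ (F.suc c)))
      ≡⟨ cong (4 *_) (∑-allAssign-suc {n} _) ⟩
    4 * ∑ (allAssign n) (λ σ → bit (s xor false) * bit (t xor σ c) + bit (s xor true) * bit (t xor σ c))
      ≡⟨ cong (4 *_) (∑-cong (allAssign n) λ {σ} _ → total (bit (t xor σ c))) ⟩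
    4 * p
      ≡⟨ *-assoc 2 2 p ⟩
    2 * (2 * p)
      ≡⟨ cong (2 *_) (∑-one-coin t c) ⟩
    2 ^ suc n ∎
    where
    open ≡-Reasoning
    p : ℕ
    p = ∑ (allAssign n) (λ σ → bit (t xor σ c))
    total : ∀ b → bit (s xor false) * b + bit (s xor true) * b ≡ b
    total b = trans (sym (*-distribʳ-+ b (bit (s xor false)) _)) (trans (cong (_* b) (bit-xor-total s)) (+-identityʳ b))
  ∑-two-coins {suc n} s t {F.suc a} {F.zero}  a≢c = trans
    (cong (4 *_) (∑-cong (allAssign (suc n)) λ {σ} _ → *-comm (bit (s xor σ (F.suc a))) (bit (t xor σ F.zero))))
    (∑-two-coins {suc n} t s {F.zero} {F.suc a} (a≢c ∘ sym))
  ∑-two-coins {suc n} s t {F.suc a} {F.suc c} a≢c = begin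
    4 * ∑ (allAssign (suc n)) (λ σ → bit (s xor σ (F.suc a)) * bit (t xor σ (F.suc c)))
      ≡⟨ cong (4 *_) (trans (∑-allAssign-suc {n} _) (∑-+ (allAssign n) _ _)) ⟩
    4 * (p + p)
      ≡⟨ double p ⟩
    2 * (4 * p)
      ≡⟨ cong (2 *_) (∑-two-coins s t (a≢c ∘ cong F.suc)) ⟩
    2 ^ suc n ∎
    where
    open ≡-Reasoning
    p : ℕ
    p = ∑ (allAssign n) (λ σ → bit (s xor σ a) * bit (t xor σ c))
    double : ∀ p → 4 * (p + p) ≡ 2 * (4 * p)
    double = solve-∀

  -- Counting wings and augmenting paths

  module Counting {n : ℕ} (G : Graph n) (M₁ M⋆ : Edges n)
    (unique₁ : Unique (endpoints M₁)) (matching⋆ : IsMatching (Adj G) M⋆) where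

    private
      V : List (Fin n)
      V = allFin n
      d o : Fin n → ℕ
      d = deg M₁
      o = free M₁
      k = length M₁
      μ = length M⋆
      N = 2 ^ n

    -- `wing` without the crossing condition: it records whether M⋆ matches the vertex to one
    -- outside V(M₁).
    freeMate : Fin n → ℕ
    freeMate = incidence M⋆ (λ _ y → o y)

    free-positive : ∀ {v} → 1 ≤ o v → v ∉ endpoints M₁
    free-positive p v∈ = 1+n≰n (subst (1 ≤_) (free-∈ M₁ v∈) p)

    wing-survives : ∀ {u a} σ → u ∈ endpoints M₁ → a ∉ endpoints M₁ → edgeGraph M⋆ u a →
      bit (side M₁ (λ _ → false) u xor σ a) ≤ wing M⋆ M₁ σ u
    wing-survives {u} {a} σ u∈ a∉ e = ≤-trans (≤-reflexive (sym crossing≡)) (incidence-∈ M⋆ (crossing M₁ σ) e)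
      where
      crossing≡ : crossing M₁ σ u a ≡ bit (side M₁ (λ _ → false) u xor σ a)
      crossing≡ rewrite free-∉ M₁ a∉ | side-∉ M₁ σ a∉ | side-∈ M₁ σ (λ _ → false) u∈ = +-identityʳ _

    -- The two free ends of a length-3 augmenting path are distinct, so both wings survive with probability 1/4.
    path-survives : ∀ {u v} → (u , v) ∈ M₁ →
      N * (freeMate u + freeMate v) ≤ N * 1 + 4 * ∑ (allAssign n) (λ σ → wing M⋆ M₁ σ u * wing M⋆ M₁ σ v)
    path-survives {u} {v} e∈ = cases (freeMate u) (freeMate v) refl refl (freeMate≤1 u) (freeMate≤1 v)
      where
      P : ℕ
      P = ∑ (allAssign n) (λ σ → wing M⋆ M₁ σ u * wing M⋆ M₁ σ v)
      freeMate≤1 : ∀ v → freeMate v ≤ 1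
      freeMate≤1 v = ≤-trans (incidence≤deg M⋆ (λ _ y → m∸n≤m 1 (deg M₁ y)) v) (unique⇒deg≤1 M⋆ (proj₂ matching⋆) v)
      both : 1 ≤ freeMate u → 1 ≤ freeMate v → N ≤ 4 * P
      both pu pv with incidence-positive M⋆ (λ _ y → o y) pu | incidence-positive M⋆ (λ _ y → o y) pv
      ... | a , ua , oa | c , vc , oc =
        ≤-trans (≤-reflexive (sym (∑-two-coins (side M₁ (λ _ → false) u) (side M₁ (λ _ → false) v) a≢c)))
        (*-monoʳ-≤ 4 (∑-mono (allAssign n) λ {σ} _ → *-mono-≤
          (wing-survives σ (∈-endpoints⁺ (inj₁ e∈)) (free-positive oa) ua)
          (wing-survives σ (∈-endpoints⁺ (inj₂ e∈)) (free-positive oc) vc)))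
        where
        a≢c : a ≢ c
        a≢c refl with mate-unique M⋆ (proj₂ matching⋆) (edgeGraph-sym M⋆ ua) (edgeGraph-sym M⋆ vc)
        ... | refl = case trans (sym (side-fst M₁ (λ _ → false) e∈)) (side-snd M₁ unique₁ (λ _ → false) e∈) of λ ()
      cases : ∀ a b → freeMate u ≡ a → freeMate v ≡ b → a ≤ 1 → b ≤ 1 → N * (a + b) ≤ N * 1 + 4 * P
      cases a b eu ev z≤n       b≤1 = ≤-trans (*-monoʳ-≤ N b≤1) (m≤m+n _ _)
      cases a b eu ev (s≤s z≤n) z≤n = m≤m+n _ _
      cases a b eu ev (s≤s z≤n) (s≤s z≤n) = ≤-trans (≤-reflexive (*-distribˡ-+ N 1 1))
        (+-monoʳ-≤ (N * 1) (≤-trans (≤-reflexive (*-identityʳ N))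
          (both (≤-reflexive (sym eu)) (≤-reflexive (sym ev)))))

    wings : ℕ
    wings = ∑ₑ M₁ (λ u v → freeMate u + freeMate v)

    paths : (Fin n → Bool) → ℕ
    paths σ = ∑ₑ M₁ (λ u v → wing M⋆ M₁ σ u * wing M⋆ M₁ σ v)

    -- An M₁-edge with `f` wings, `f` ≤ 2, carries at least `f` - 1 augmenting paths. So there are
    -- at least `wings` - `k` paths, and a quarter of them survive on average.
    expected-paths : N * wings ≤ N * k + 4 * ∑ (allAssign n) paths
    expected-paths = begin
      N * wings                                     ≡⟨ ∑-* N M₁ _ ⟨
      ∑ₑ M₁ (λ u v → N * (freeMate u + freeMate v)) ≤⟨ ∑-mono M₁ path-survives ⟩
      ∑ₑ M₁ (λ u v → N * 1 + 4 * survivors u v)     ≡⟨ ∑-+ M₁ _ _ ⟩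
      ∑ M₁ (λ _ → N * 1) + ∑ₑ M₁ (λ u v → 4 * survivors u v)
        ≡⟨ cong₂ _+_ (trans (∑-const (N * 1) M₁) (trans (*-comm k (N * 1)) (cong (_* k) (*-identityʳ N))))
                     (trans (∑-* 4 M₁ _) (cong (4 *_) (∑-comm M₁ (allAssign n) _))) ⟩
      N * k + 4 * ∑ (allAssign n) paths             ∎
      where
      open ≤-Reasoning
      survivors : Fin n → Fin n → ℕ
      survivors u v = ∑ (allAssign n) (λ σ → wing M⋆ M₁ σ u * wing M⋆ M₁ σ v)

    module _ (S : List (Fin n))
      (maximal : ∀ u v → deleteVertices (Adj G) S u v → (u ∈ endpoints M₁) ⊎ (v ∈ endpoints M₁)) where

      private
        s : Fin n → ℕ
        s v = ∑ S (λ a → δ a v)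

        ∑s : ∑ V s ≡ length S
        ∑s = trans (∑-comm V S (λ v a → δ a v))
          (trans (∑-cong S λ {a} _ → trans (∑-cong V λ _ → sym (+-identityʳ _)) (∑-δ a (λ _ → 1)))
          (trans (∑-const 1 S) (*-identityʳ _)))

        1≤s : ∀ {v} → v ∈ S → 1 ≤ s v
        1≤s {v} v∈ = subst (_≤ s v) (δ-refl v) (∑-∈ (λ a → δ a v) v∈)

        ∑d : ∑ V d ≡ 2 * k
        ∑d = trans (∑-cong V λ {v} _ → sym (+-identityʳ (d v)))
          (trans (handshake-deg M₁ (λ _ → 1)) (trans (∑-const 2 M₁) (*-comm k 2)))

        ∑⋆ : (f : Fin n → ℕ) → ∑ₑ M⋆ (λ u v → f u + f v) ≤ ∑ V f
        ∑⋆ f = ≤-trans (≤-reflexive (sym (handshake-deg M⋆ f))) (∑-mono V λ {v} _ →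
          ≤-trans (*-monoʳ-≤ (f v) (unique⇒deg≤1 M⋆ (proj₂ matching⋆) v)) (≤-reflexive (*-identityʳ _)))

        touched : ∀ {u v} → Adj G u v → 1 ≤ (d u + d v) + (s u + s v)
        touched {u} {v} uv with any? (u ≟_) S | any? (v ≟_) S
        ... | yes u∈ | _      = ≤-trans (1≤s u∈) (≤-trans (m≤m+n (s u) (s v)) (m≤n+m _ (d u + d v)))
        ... | no _   | yes v∈ = ≤-trans (1≤s v∈) (≤-trans (m≤n+m (s v) (s u)) (m≤n+m _ (d u + d v)))
        ... | no u∉  | no v∉ with maximal u v (uv , u∉ , v∉)
        ... | inj₁ u∈ = ≤-trans (∈⇒1≤deg M₁ u∈) (≤-trans (m≤m+n (d u) (d v)) (m≤m+n _ (s u + s v)))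
        ... | inj₂ v∈ = ≤-trans (∈⇒1≤deg M₁ v∈) (≤-trans (m≤n+m (d v) (d u)) (m≤m+n _ (s u + s v)))

        -- An edge of M⋆ with one end in V(M₁) gives a wing and an endpoint, one with both ends
        -- there gives two endpoints, and one with none must touch S, which is counted twice.
        arithmetic : ∀ a b c → a ≤ 1 → b ≤ 1 → 1 ≤ (a + b) + c →
          2 ≤ (a * (1 ∸ b) + b * (1 ∸ a)) + ((a + b) + 2 * c)
        arithmetic a b c z≤n       z≤n       p = *-monoʳ-≤ 2 p
        arithmetic a b c z≤n       (s≤s z≤n) p = s≤s (s≤s z≤n)
        arithmetic a b c (s≤s z≤n) z≤n       p = s≤s (s≤s z≤n)
        arithmetic a b c (s≤s z≤n) (s≤s z≤n) p = s≤s (s≤s z≤n)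

      μ-upper-bound : μ ≤ 2 * k + length S
      μ-upper-bound = begin
        μ                                             ≡⟨ trans (∑-const 1 M⋆) (*-identityʳ μ) ⟨
        ∑ M⋆ (λ _ → 1)                                ≤⟨ ∑-mono M⋆ (λ e∈ → touched (All.lookup (proj₁ matching⋆) e∈)) ⟩
        ∑ₑ M⋆ (λ u v → (d u + d v) + (s u + s v))     ≡⟨ ∑-+ M⋆ _ _ ⟩
        ∑ₑ M⋆ (λ u v → d u + d v) + ∑ₑ M⋆ (λ u v → s u + s v) ≤⟨ +-mono-≤ (∑⋆ d) (∑⋆ s) ⟩
        ∑ V d + ∑ V s                                 ≡⟨ cong₂ _+_ ∑d ∑s ⟩
        2 * k + length S                              ∎
        where open ≤-Reasoning

      wings-lower-bound : 2 * μ ≤ wings + (2 * k + 2 * length S)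
      wings-lower-bound = begin
        2 * μ                                         ≡⟨ trans (∑-const 2 M⋆) (*-comm μ 2) ⟨
        ∑ M⋆ (λ _ → 2)
          ≤⟨ ∑-mono M⋆ (λ {e} e∈ → arithmetic (d (proj₁ e)) (d (proj₂ e)) _
               (unique⇒deg≤1 M₁ unique₁ _) (unique⇒deg≤1 M₁ unique₁ _) (touched (All.lookup (proj₁ matching⋆) e∈))) ⟩
        ∑ₑ M⋆ (λ u v → (d u * o v + d v * o u) + ((d u + d v) + 2 * (s u + s v)))
          ≡⟨ trans (∑-+ M⋆ _ _) (cong (f⋆ +_) (∑-+ M⋆ _ _)) ⟩
        f⋆ + (d⋆ + ∑ₑ M⋆ (λ u v → 2 * (s u + s v)))
          ≡⟨ cong₂ (λ p q → p + (d⋆ + q)) wings≡ (sym (∑-* 2 M⋆ (λ e → s (proj₁ e) + s (proj₂ e)))) ⟨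
        wings + (d⋆ + 2 * ∑ₑ M⋆ (λ u v → s u + s v))
          ≤⟨ +-monoʳ-≤ wings (+-mono-≤ (∑⋆ d) (*-monoʳ-≤ 2 (∑⋆ s))) ⟩
        wings + (∑ V d + 2 * ∑ V s)                   ≡⟨ cong₂ (λ p q → wings + (p + 2 * q)) ∑d ∑s ⟩
        wings + (2 * k + 2 * length S)                ∎
        where
        open ≤-Reasoning
        f⋆ d⋆ : ℕ
        f⋆ = ∑ₑ M⋆ (λ u v → d u * o v + d v * o u)
        d⋆ = ∑ₑ M⋆ (λ u v → d u + d v)
        -- The same wings, counted from the M₁-edges and from the M⋆-edges.
        wings≡ : wings ≡ f⋆
        wings≡ = trans (sym (handshake-deg M₁ freeMate))
          (trans (∑-cong V λ {v} _ → *-comm (freeMate v) (d v)) (handshake M⋆ d (λ _ y → o y)))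

  -- Combining the bounds

  private
    -- The multipliers 18, 8 and 18N cancel `Q` and `f`, which leaves `k` with coefficient 712 - 18
    -- - 36 = 2 · 329. As this is positive, the last hypothesis enters with factor 329N. The result
    -- is 5 times the claim, since 36 + 329 = 5 · 73 and 8 · 90 = 5 · 144.
    combine : ∀ N k μ s f Q E → N * f ≤ N * k + 4 * Q → N * (89 * k) + 9 * Q ≤ 90 * E →
      2 * μ ≤ f + (2 * k + 2 * s) → μ ≤ 2 * k + s → 73 * (N * μ) ≤ 144 * E + 73 * (N * s)
    combine N k μ s f Q E a b c e = *-cancelˡ-≤ 5 (+-cancelʳ-≤ (712 * (N * k) + 72 * Q + 18 * (N * f)) _ _ (begin
      5 * (73 * (N * μ)) + (712 * (N * k) + 72 * Q + 18 * (N * f))   ≡⟨ left N k μ f Q ⟩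
      18 * (N * f) + 8 * (N * (89 * k) + 9 * Q) + (18 * N) * (2 * μ) + (329 * N) * μ
        ≤⟨ +-mono-≤ (+-mono-≤ (+-mono-≤ (*-monoʳ-≤ 18 a) (*-monoʳ-≤ 8 b)) (*-monoʳ-≤ (18 * N) c)) (*-monoʳ-≤ (329 * N) e) ⟩
      18 * (N * k + 4 * Q) + 8 * (90 * E) + (18 * N) * (f + (2 * k + 2 * s)) + (329 * N) * (2 * k + s)
        ≡⟨ right N k s f Q E ⟩
      5 * (144 * E + 73 * (N * s)) + (712 * (N * k) + 72 * Q + 18 * (N * f)) ∎))
      where
      open ≤-Reasoning
      left : ∀ N k μ f Q → 5 * (73 * (N * μ)) + (712 * (N * k) + 72 * Q + 18 * (N * f))
        ≡ 18 * (N * f) + 8 * (N * (89 * k) + 9 * Q) + (18 * N) * (2 * μ) + (329 * N) * μ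
      left = solve-∀
      right : ∀ N k s f Q E → 18 * (N * k + 4 * Q) + 8 * (90 * E) + (18 * N) * (f + (2 * k + 2 * s)) + (329 * N) * (2 * k + s)
        ≡ 5 * (144 * E + 73 * (N * s)) + (712 * (N * k) + 72 * Q + 18 * (N * f))
      right = solve-∀

  deleteVertices-matching : (G : Graph n) {S : List (Fin n)} {M : Edges n} →
    IsMatching (deleteVertices (Adj G) S) M → IsMatching (Adj G) M
  deleteVertices-matching G (hs , uniq) = All.map proj₁ hs , uniq

  module Procedure {n : ℕ} (G : Graph n) {μ : ℕ} (isMu : IsMu (Adj G) μ) (M₁ : Edges n) {S : List (Fin n)}
    (maximal₁ : IsMaximalMatching (deleteVertices (Adj G) S) M₁)
    (M₂ : (Fin n → Bool) → Edges n) (maximal₂ : ∀ σ → IsMaximalBMatching (E₂ G M₁ σ) (capacity 9 M₁) (M₂ σ))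
    (mu : (Fin n → Bool) → ℕ) (isMus : ∀ σ → IsMu (edgeGraph (M₁ ++ M₂ σ)) (mu σ)) where

    private
      M⋆ : Edges n
      M⋆ = proj₁ (proj₁ isMu)
      matching⋆ : IsMatching (Adj G) M⋆
      matching⋆ = proj₁ (proj₂ (proj₁ isMu))
      matching₁ : IsMatching (Adj G) M₁
      matching₁ = deleteVertices-matching G (proj₁ maximal₁)

    open Counting G M₁ M⋆ (proj₂ matching₁) matching⋆

    total-upper-bound : ∑ (allAssign n) mu ≤ 2 ^ n * μ
    total-upper-bound = ≤-trans (∑-mono (allAssign n) λ {σ} _ → bound σ) (≤-reflexive (∑-allAssign-const n μ))
      where
      E₂⊆Adj : ∀ σ {u v} → E₂ G M₁ σ u v → Adj G u v
      E₂⊆Adj σ (inj₁ (uv , _)) = uv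
      E₂⊆Adj σ (inj₂ (vu , _)) = symm G vu
      bound : ∀ σ → mu σ ≤ μ
      bound σ with isMus σ
      ... | (M , (hs , uniq) , len) , _ = subst (_≤ μ) len (proj₂ isMu M
        (All.map (edgeGraph-⊆ (symm G) (All.++⁺ (proj₁ matching₁) (All.map (E₂⊆Adj σ) (proj₁ (proj₁ (maximal₂ σ)))))) hs , uniq))

    total-lower-bound : 73 * (2 ^ n * μ) ≤ 144 * ∑ (allAssign n) mu + 73 * (2 ^ n * length S)
    total-lower-bound = combine (2 ^ n) (length M₁) μ (length S) wings (∑ (allAssign n) paths) (∑ (allAssign n) mu)
      expected-paths summed
      (subst (λ m → 2 * m ≤ wings + (2 * length M₁ + 2 * length S)) length⋆ (wings-lower-bound S (proj₂ maximal₁)))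
      (subst (_≤ 2 * length M₁ + length S) length⋆ (μ-upper-bound S (proj₂ maximal₁)))
      where
      open ≤-Reasoning
      length⋆ : length M⋆ ≡ μ
      length⋆ = proj₂ (proj₂ (proj₁ isMu))
      summed : 2 ^ n * (89 * length M₁) + 9 * ∑ (allAssign n) paths ≤ 90 * ∑ (allAssign n) mu
      summed = begin
        2 ^ n * (89 * length M₁) + 9 * ∑ (allAssign n) paths
          ≡⟨ cong₂ _+_ (∑-allAssign-const n _) (∑-* 9 (allAssign n) paths) ⟨
        ∑ (allAssign n) (λ _ → 89 * length M₁) + ∑ (allAssign n) (λ σ → 9 * paths σ)
          ≡⟨ ∑-+ (allAssign n) _ _ ⟨
        ∑ (allAssign n) (λ σ → 89 * length M₁ + 9 * paths σ)
          ≤⟨ ∑-mono (allAssign n) (λ {σ} _ →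
               Bipartition.μ-lower-bound G M₁ M⋆ matching₁ matching⋆ σ (M₂ σ) (maximal₂ σ) (isMus σ)) ⟩
        ∑ (allAssign n) (λ σ → 90 * mu σ)
          ≡⟨ ∑-* 90 (allAssign n) mu ⟩
        90 * ∑ (allAssign n) mu ∎

open Combinatorics using (module Procedure)

open import Data.Nat using (ℕ)
open import Data.Fin using (Fin)
open import Data.Bool using (Bool)
open import Data.List using (_++_; length; map)
open import Data.Product using (_×_; _,_)
open import Data.Integer using (+_)
open import Data.Rational using (ℚ; _/_; _<_; _≤_; _*_; _+_; _-_; 0ℚ; ½; -_; toℚᵘ; Positive; nonNegative)
open import Data.Nat as ℕ using (suc; _^_; NonZero)
open import Data.Nat.ListAction using (sum)
import Data.Nat.Properties as ℕ
import Data.Integer as ℤ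
import Data.Integer.Properties as ℤ
open import Data.Rational.Properties
open import Data.Rational.Solver using (module +-*-Solver)
open import Data.Rational.Unnormalised as ℚᵘ using (mkℚᵘ; *≡*; *≤*)
import Data.Rational.Unnormalised.Properties as ℚᵘ
open import Relation.Binary.PropositionalEquality using (_≡_; refl; sym; trans; cong; cong₂)

-- Passage to the rationals

toℚᵘ-toℚ : ∀ a → toℚᵘ (toℚ a) ℚᵘ.≃ mkℚᵘ (+ a) 0
toℚᵘ-toℚ a = toℚᵘ-fromℚᵘ (mkℚᵘ (+ a) 0)

toℚ-+ : ∀ a b → toℚ (a ℕ.+ b) ≡ toℚ a + toℚ b
toℚ-+ a b = toℚᵘ-injective (begin
  toℚᵘ (toℚ (a ℕ.+ b))               ≈⟨ toℚᵘ-toℚ (a ℕ.+ b) ⟩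
  mkℚᵘ (+ (a ℕ.+ b)) 0               ≈⟨ *≡* (cong (ℤ._* + 1) (sym (cong₂ ℤ._+_ (ℤ.*-identityʳ (+ a)) (ℤ.*-identityʳ (+ b))))) ⟩
  mkℚᵘ (+ a) 0 ℚᵘ.+ mkℚᵘ (+ b) 0     ≈⟨ ℚᵘ.+-cong (toℚᵘ-toℚ a) (toℚᵘ-toℚ b) ⟨
  toℚᵘ (toℚ a) ℚᵘ.+ toℚᵘ (toℚ b)     ≈⟨ toℚᵘ-homo-+ (toℚ a) (toℚ b) ⟨
  toℚᵘ (toℚ a + toℚ b)               ∎)
  where open ℚᵘ.≃-Reasoning

toℚ-* : ∀ a b → toℚ (a ℕ.* b) ≡ toℚ a * toℚ b
toℚ-* a b = toℚᵘ-injective (begin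
  toℚᵘ (toℚ (a ℕ.* b))               ≈⟨ toℚᵘ-toℚ (a ℕ.* b) ⟩
  mkℚᵘ (+ (a ℕ.* b)) 0               ≈⟨ *≡* (cong (ℤ._* + 1) (ℤ.pos-* a b)) ⟩
  mkℚᵘ (+ a) 0 ℚᵘ.* mkℚᵘ (+ b) 0     ≈⟨ ℚᵘ.*-cong (toℚᵘ-toℚ a) (toℚᵘ-toℚ b) ⟨
  toℚᵘ (toℚ a) ℚᵘ.* toℚᵘ (toℚ b)     ≈⟨ toℚᵘ-homo-* (toℚ a) (toℚ b) ⟨
  toℚᵘ (toℚ a * toℚ b)               ∎)
  where open ℚᵘ.≃-Reasoning

toℚ-mono : ∀ {a b} → a ℕ.≤ b → toℚ a ≤ toℚ b
toℚ-mono {a} {b} a≤b = toℚᵘ-cancel-≤ (begin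
  toℚᵘ (toℚ a)    ≃⟨ toℚᵘ-toℚ a ⟩
  mkℚᵘ (+ a) 0    ≤⟨ *≤* (ℤ.*-monoʳ-≤-nonNeg (+ 1) (ℤ.+≤+ a≤b)) ⟩
  mkℚᵘ (+ b) 0    ≃⟨ toℚᵘ-toℚ b ⟨
  toℚᵘ (toℚ b)    ∎)
  where open ℚᵘ.≤-Reasoning

quotient-* : ∀ a d .{{_ : NonZero d}} → (+ a / d) * toℚ d ≡ toℚ a
quotient-* a (suc d) = toℚᵘ-injective (begin
  toℚᵘ ((+ a / suc d) * toℚ (suc d))             ≈⟨ toℚᵘ-homo-* (+ a / suc d) (toℚ (suc d)) ⟩
  toℚᵘ (+ a / suc d) ℚᵘ.* toℚᵘ (toℚ (suc d))     ≈⟨ ℚᵘ.*-cong (toℚᵘ-fromℚᵘ (mkℚᵘ (+ a) d)) (toℚᵘ-toℚ (suc d)) ⟩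
  mkℚᵘ (+ a) d ℚᵘ.* mkℚᵘ (+ suc d) 0             ≈⟨ *≡* (trans (ℤ.*-identityʳ _) (cong (λ e → + a ℤ.* + e) (sym (ℕ.*-identityʳ (suc d))))) ⟩
  mkℚᵘ (+ a) 0                                   ≈⟨ toℚᵘ-toℚ a ⟨
  toℚᵘ (toℚ a)                                   ∎)
  where open ℚᵘ.≃-Reasoning

toℚ-positive : ∀ d .{{_ : NonZero d}} → Positive (toℚ d)
toℚ-positive d = normalize-pos d 1

quotient-≤ : ∀ {a d m} .{{_ : NonZero d}} → a ℕ.≤ d ℕ.* m → + a / d ≤ toℚ m
quotient-≤ {a} {d} {m} a≤dm = *-cancelʳ-≤-pos (toℚ d) {{toℚ-positive d}} (begin
  (+ a / d) * toℚ d    ≡⟨ quotient-* a d ⟩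
  toℚ a                ≤⟨ toℚ-mono a≤dm ⟩
  toℚ (d ℕ.* m)        ≡⟨ trans (toℚ-* d m) (*-comm (toℚ d) (toℚ m)) ⟩
  toℚ m * toℚ d        ∎)
  where open ≤-Reasoning

quotient-≥ : ∀ a d m s .{{_ : NonZero d}} → 73 ℕ.* (d ℕ.* m) ℕ.≤ 144 ℕ.* a ℕ.+ 73 ℕ.* (d ℕ.* s) →
  toℚ 73 * toℚ m ≤ toℚ 144 * (+ a / d) + toℚ 73 * toℚ s
quotient-≥ a d m s h = *-cancelʳ-≤-pos (toℚ d) {{toℚ-positive d}} (begin
  toℚ 73 * toℚ m * toℚ d                                     ≡⟨ rotate (toℚ 73) (toℚ m) (toℚ d) ⟩
  toℚ 73 * (toℚ d * toℚ m)                                   ≡⟨ product m ⟨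
  toℚ (73 ℕ.* (d ℕ.* m))                                     ≤⟨ toℚ-mono h ⟩
  toℚ (144 ℕ.* a ℕ.+ 73 ℕ.* (d ℕ.* s))                       ≡⟨ toℚ-+ (144 ℕ.* a) (73 ℕ.* (d ℕ.* s)) ⟩
  toℚ (144 ℕ.* a) + toℚ (73 ℕ.* (d ℕ.* s))                   ≡⟨ cong₂ _+_ (toℚ-* 144 a) (product s) ⟩
  toℚ 144 * toℚ a + toℚ 73 * (toℚ d * toℚ s)                 ≡⟨ cong (λ p → toℚ 144 * p + toℚ 73 * (toℚ d * toℚ s)) (quotient-* a d) ⟨
  toℚ 144 * ((+ a / d) * toℚ d) + toℚ 73 * (toℚ d * toℚ s)   ≡⟨ collect (toℚ 144) (+ a / d) (toℚ d) (toℚ 73) (toℚ s) ⟩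
  (toℚ 144 * (+ a / d) + toℚ 73 * toℚ s) * toℚ d             ∎)
  where
  open ≤-Reasoning
  open +-*-Solver
  product : ∀ m → toℚ (73 ℕ.* (d ℕ.* m)) ≡ toℚ 73 * (toℚ d * toℚ m)
  product m = trans (toℚ-* 73 (d ℕ.* m)) (cong (toℚ 73 *_) (toℚ-* d m))
  rotate : ∀ p q r → p * q * r ≡ p * (r * q)
  rotate = solve 3 (λ p q r → p :* q :* r := p :* (r :* q)) refl
  collect : ∀ p e d q s → p * (e * d) + q * (d * s) ≡ (p * e + q * s) * d
  collect = solve 5 (λ p e d q s → p :* (e :* d) :+ q :* (d :* s) := (p :* e :+ q :* s) :* d) refl

-- After scaling by 144 the deleted vertices cost at most (73/4)εm, while the claim concedes 144εm.
-- The difference (503/4)εm is nonnegative and dropped.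
approximation : ∀ {ε m s e} → 0ℚ ≤ ε → 0ℚ ≤ m → s ≤ ε * (+ 1 / 4) * m →
  toℚ 73 * m ≤ toℚ 144 * e + toℚ 73 * s → ((½ + + 1 / 144) - ε) * m ≤ e
approximation {ε} {m} {s} {e} 0≤ε 0≤m s≤ h = *-cancelˡ-≤-pos (toℚ 144) (begin
  toℚ 144 * (((½ + + 1 / 144) - ε) * m)                                    ≡⟨ expand ε m ⟩
  toℚ 73 * m - toℚ 144 * (ε * m)                                           ≤⟨ +-monoˡ-≤ (- (toℚ 144 * (ε * m))) h ⟩
  toℚ 144 * e + toℚ 73 * s - toℚ 144 * (ε * m)                             ≤⟨ +-monoˡ-≤ (- (toℚ 144 * (ε * m))) (+-monoʳ-≤ (toℚ 144 * e) (*-monoˡ-≤-nonNeg (toℚ 73) s≤)) ⟩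
  toℚ 144 * e + toℚ 73 * (ε * (+ 1 / 4) * m) - toℚ 144 * (ε * m)           ≡⟨ collect ε m e ⟩
  toℚ 144 * e - (+ 503 / 4) * (ε * m)                                      ≤⟨ +-monoʳ-≤ (toℚ 144 * e) (neg-antimono-≤ 0≤slack) ⟩
  toℚ 144 * e - 0ℚ                                                         ≡⟨ +-identityʳ _ ⟩
  toℚ 144 * e                                                              ∎)
  where
  open ≤-Reasoning
  open +-*-Solver
  0≤slack : 0ℚ ≤ (+ 503 / 4) * (ε * m)
  0≤slack = begin
    0ℚ                          ≡⟨ *-zeroʳ (+ 503 / 4) ⟨
    (+ 503 / 4) * 0ℚ            ≡⟨ cong ((+ 503 / 4) *_) (*-zeroʳ ε) ⟨
    (+ 503 / 4) * (ε * 0ℚ)      ≤⟨ *-monoˡ-≤-nonNeg (+ 503 / 4) (*-monoˡ-≤-nonNeg ε {{nonNegative 0≤ε}} 0≤m) ⟩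
    (+ 503 / 4) * (ε * m)       ∎
  expand : ∀ ε m → toℚ 144 * (((½ + + 1 / 144) - ε) * m) ≡ toℚ 73 * m - toℚ 144 * (ε * m)
  expand = solve 2 (λ ε m → con (toℚ 144) :* (((con ½ :+ con (+ 1 / 144)) :- ε) :* m)
                            := con (toℚ 73) :* m :- con (toℚ 144) :* (ε :* m)) refl
  collect : ∀ ε m e → toℚ 144 * e + toℚ 73 * (ε * (+ 1 / 4) * m) - toℚ 144 * (ε * m)
                    ≡ toℚ 144 * e - (+ 503 / 4) * (ε * m)
  collect = solve 3 (λ ε m e → con (toℚ 144) :* e :+ con (toℚ 73) :* (ε :* con (+ 1 / 4) :* m) :- con (toℚ 144) :* (ε :* m)
                               := con (toℚ 144) :* e :- con (+ 503 / 4) :* (ε :* m)) refl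

theorem4p4 : (ε : ℚ) → 0ℚ < ε → ε < + 1 / 4 →
    (n : ℕ) (G : Graph n) (mG : ℕ) → IsMu (Adj G) mG →
    (M1 : Edges n) → IsApproxMaximal (Adj G) mG (ε * (+ 1 / 4)) M1 →
    (M2 : (Fin n → Bool) → Edges n) →
    (∀ σ → IsMaximalBMatching (E₂ G M1 σ) (capacity 9 M1) (M2 σ)) →
    (mu : (Fin n → Bool) → ℕ) →
    (∀ σ → IsMu (edgeGraph (M1 ++ M2 σ)) (mu σ)) →
    (expect n mu ≤ toℚ mG)
    × (((½ + + 1 / 144) - ε) * toℚ mG ≤ expect n mu)
theorem4p4 ε 0<ε _ n G mG isMu M1 (S , _ , |S|≤ , maximal₁) M2 maximal₂ mu isMus =
    quotient-≤ {{ℕ.m^n≢0 2 n}} total-upper-bound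
  , approximation (<⇒≤ 0<ε) (toℚ-mono {b = mG} ℕ.z≤n) |S|≤
      (quotient-≥ (sum (map mu (allAssign n))) (2 ^ n) mG (length S) {{ℕ.m^n≢0 2 n}} total-lower-bound)
  where open Procedure G isMu M1 maximal₁ M2 maximal₂ mu isMus
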